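{- For all integers $m,n\geq 0$, \[ F_{m,n}(q,t) = q^{m+n}\, H_{m,n}\!\left(\frac{q+1}{q}, \frac{t+1}{q+1}\right). \]
   Context: Fix $m,n\geq 0$ and disjoint alphabets $X=\{x_1,\dots,x_m\}$, $Y=\{y_1,\dots,y_n\}$. A shuffle word is a word over $X\cup Y$ without repeated letters in which $x_i$ precedes $x_j$ and $y_i$ precedes $y_j$ whenever both letters occur and $i<j$; $\mathsf{Shuf}(m,n)$ is the set of shuffle words. The bubble lattice $\mathbf{Bub}(m,n)$ is $\mathsf{Shuf}(m,n)$ ordered by the reflexive–transitive closure of the following elementary moves $\mathbf u\to\mathbf v$: (indel) $\mathbf v$ is obtained from $\mathbf u$ by deleting a letter of $X$ or by inserting a letter of $Y$; (transposition) $\mathbf v$ is obtained from $\mathbf u$ by replacing a consecutive factor $xy$ ($x\in X$, $y\in Y$) by $yx$. For $\mathbf u\in\mathsf{Shuf}(m,n)$ let $\mathsf{in}(\mathbf u)$ be the number of elements covered by $\mathbf u$ in $\mathbf{Bub}(m,n)$, and $\mathsf{in}_{\mathrm{indel}}(\mathbf u)$ the number of those lower covers $\mathbf u'$ for which $\mathbf u'$ and $\mathbf u$ differ by an indel (i.e. have different sets of letters). The $H$-triangle is $H_{m,n}(q,t)=\sum_{\mathbf u\in\mathsf{Shuf}(m,n)} q^{\mathsf{in}(\mathbf u)}t^{\mathsf{in}_{\mathrm{indel}}(\mathbf u)}$. Let $\tilde X=X\cup\{x_0\}$, $\tilde Y=Y\cup\{y_0\}$ with new letters $x_0,y_0$.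 Loops are the elements of $\mathcal L=X\uplus Y$, edges are the elements of $\tilde{\mathcal E}=\{\{x,y\}: x\in\tilde X,y\in\tilde Y\}\setminus\{\{x_0,y_0\}\}$. The noncrossing bipartite complex $\Delta(m,n)$ is the simplicial complex on vertex set $\mathcal L\uplus\tilde{\mathcal E}$ whose faces are the sets $\sigma$ such that (i) if $\{x,y\}\in\sigma$ then $x\notin\sigma$ and $y\notin\sigma$, and (ii) if $\{x_{s_1},y_{t_1}\},\{x_{s_2},y_{t_2}\}\in\sigma$ with $s_1<s_2$ then $t_1<t_2$. The $F$-triangle is $F_{m,n}(q,t)=\sum_{\sigma\in\Delta(m,n)} q^{|\sigma\cap\tilde{\mathcal E}|}t^{|\sigma\cap\mathcal L|}$.
   Formalization: Condition (ii) of the noncrossing complex is taken as t_1 ≤ t_2 instead of t_1 < t_2 (the strict version makes the identity fail for m=n=1, by q^2); the identity is stated for all rational q, t with q ≠ 0, −1, which determines the polynomials. -}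

module Defs where

open import Data.Nat as ℕ using (ℕ; zero; suc; _<ᵇ_)
open import Data.Fin as Fin using (Fin; toℕ)
open import Data.Bool using (Bool; true; false; _∧_; _∨_; not; T; if_then_else_)
open import Data.List using (List; []; _∷_; _++_; map; concatMap; filterᵇ; length; foldr; allFin; upTo)
open import Data.Bool.ListAction using (all; any)
open import Data.List.Membership.Propositional using (_∈_)
open import Data.List.Relation.Unary.Unique.Propositional using (Unique)
open import Data.Product using (Σ; _×_; _,_)
open import Data.Empty using (⊥)
open import Relation.Nullary using (¬_; does)
open import Relation.Binary.PropositionalEquality using (_≡_; _≢_)
open import Relation.Binary.Construct.Closure.ReflexiveTransitive using (Star)
open import Data.Rational as ℚ using (ℚ; 0ℚ; 1ℚ)

pow : ℚ → ℕ → ℚ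
pow q zero    = 1ℚ
pow q (suc k) = q ℚ.* pow q k

sumℚ : List ℚ → ℚ
sumℚ = foldr ℚ._+_ 0ℚ

-- all subsets of a list, each given as an order-preserving sublist
-- (one canonical representative per subset when the list is duplicate-free)
sublists : {A : Set} → List A → List (List A)
sublists []       = [] ∷ []
sublists (a ∷ as) = map (a ∷_) (sublists as) ++ sublists as

countᵇ : {A : Set} → (A → Bool) → List A → ℕ
countᵇ p xs = length (filterᵇ p xs)

incr : List ℕ → Bool
incr []           = true
incr (a ∷ [])     = true
incr (a ∷ b ∷ as) = (a <ᵇ b) ∧ incr (b ∷ as)

-- Shuffle words.  X = {x_1..x_m} is encoded by Fin m (xl i = x_{i+1}),
-- Y = {y_1..y_n} by Fin n.

data Letter (m n : ℕ) : Set where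
  xl : Fin m → Letter m n
  yl : Fin n → Letter m n

Word : ℕ → ℕ → Set
Word m n = List (Letter m n)

xIdx : ∀ {m n} → Word m n → List ℕ
xIdx []          = []
xIdx (xl i ∷ w)  = toℕ i ∷ xIdx w
xIdx (yl j ∷ w)  = xIdx w

yIdx : ∀ {m n} → Word m n → List ℕ
yIdx []          = []
yIdx (xl i ∷ w)  = yIdx w
yIdx (yl j ∷ w)  = toℕ j ∷ yIdx w

-- no repeated letters and x_i before x_j, y_i before y_j for i<j:
-- equivalently the X-indices and the Y-indices are strictly increasing
isShuf : ∀ {m n} → Word m n → Bool
isShuf w = incr (xIdx w) ∧ incr (yIdx w)

letters : (m n : ℕ) → List (Letter m n)
letters m n = map xl (allFin m) ++ map yl (allFin n)

wordsOfLen : (m n : ℕ) → ℕ → List (Word m n)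
wordsOfLen m n zero    = [] ∷ []
wordsOfLen m n (suc k) = concatMap (λ a → map (a ∷_) (wordsOfLen m n k)) (letters m n)

wordsUpTo : (m n : ℕ) → ℕ → List (Word m n)
wordsUpTo m n k = concatMap (wordsOfLen m n) (upTo (suc k))

-- Shuf(m,n) (each shuffle word has length ≤ m+n and occurs exactly once)
Shuf : (m n : ℕ) → List (Word m n)
Shuf m n = filterᵇ isShuf (wordsUpTo m n (m ℕ.+ n))

data Step {m n : ℕ} : Word m n → Word m n → Set where
  delX  : ∀ p s i → T (isShuf (p ++ xl i ∷ s)) → T (isShuf (p ++ s)) →
          Step (p ++ xl i ∷ s) (p ++ s)
  insY  : ∀ p s j → T (isShuf (p ++ s)) → T (isShuf (p ++ yl j ∷ s)) →
          Step (p ++ s) (p ++ yl j ∷ s)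
  trans : ∀ p s i j → T (isShuf (p ++ xl i ∷ yl j ∷ s)) →
          T (isShuf (p ++ yl j ∷ xl i ∷ s)) →
          Step (p ++ xl i ∷ yl j ∷ s) (p ++ yl j ∷ xl i ∷ s)

_≤B_ : ∀ {m n} → Word m n → Word m n → Set
u ≤B v = Star Step u v

_<B_ : ∀ {m n} → Word m n → Word m n → Set
u <B v = u ≤B v × u ≢ v

CoveredBy : ∀ {m n} → Word m n → Word m n → Set
CoveredBy u v = T (isShuf v) × v <B u × ¬ (Σ _ λ w → v <B w × w <B u)

SameLetters : ∀ {m n} → Word m n → Word m n → Set
SameLetters u v = ∀ a → (a ∈ u → a ∈ v) × (a ∈ v → a ∈ u)

IndelCoveredBy : ∀ {m n} → Word m n → Word m n → Set
IndelCoveredBy u v = CoveredBy u v × ¬ SameLetters u v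

HasCount : ∀ {m n} → (Word m n → Set) → ℕ → Set
HasCount {m} {n} P k =
  Σ (List (Word m n)) λ L → Unique L × length L ≡ k ×
    (∀ w → (w ∈ L → P w) × (P w → w ∈ L))

-- H-triangle, given the statistics in = inC and in_indel = inI
-- (the theorem assumes inC, inI are the true counts of lower covers)
Htri : (m n : ℕ) → (inC inI : Word m n → ℕ) → ℚ → ℚ → ℚ
Htri m n inC inI q t = sumℚ (map (λ u → pow q (inC u) ℚ.* pow t (inI u)) (Shuf m n))

-- Noncrossing bipartite complex Δ(m,n).
-- Edge indices: Fin (suc m) with zero = x_0 and suc i = xl i; same for Y.

data Vertex (m n : ℕ) : Set where
  loopX : Fin m → Vertex m n
  loopY : Fin n → Vertex m n
  edge  : Fin (suc m) → Fin (suc n) → Vertex m n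

isEdge : ∀ {m n} → Vertex m n → Bool
isEdge (edge _ _) = true
isEdge _          = false

isLoop : ∀ {m n} → Vertex m n → Bool
isLoop v = not (isEdge v)

notBothZero : ∀ {m n} → Fin (suc m) → Fin (suc n) → Bool
notBothZero Fin.zero Fin.zero = false
notBothZero _        _        = true

vertices : (m n : ℕ) → List (Vertex m n)
vertices m n =
  map loopX (allFin m) ++ map loopY (allFin n) ++
  filterᵇ (λ { (edge a b) → notBothZero a b ; _ → false })
    (concatMap (λ a → map (edge a) (allFin (suc n))) (allFin (suc m)))

eqF : ∀ {k} → Fin k → Fin k → Bool
eqF i j = does (i Fin.≟ j)

eqV : ∀ {m n} → Vertex m n → Vertex m n → Bool
eqV (loopX i)  (loopX j)  = eqF i j
eqV (loopY i)  (loopY j)  = eqF i j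
eqV (edge a b) (edge c d) = eqF a c ∧ eqF b d
eqV _          _          = false

memᵇ : ∀ {m n} → Vertex m n → List (Vertex m n) → Bool
memᵇ v σ = any (eqV v) σ

condI : ∀ {m n} → List (Vertex m n) → Bool
condI σ = all ok σ
  where
  okX : ∀ {m n} → Fin (suc m) → List (Vertex m n) → Bool
  okX Fin.zero    σ = true
  okX (Fin.suc i) σ = not (memᵇ (loopX i) σ)
  okY : ∀ {m n} → Fin (suc n) → List (Vertex m n) → Bool
  okY Fin.zero    σ = true
  okY (Fin.suc j) σ = not (memᵇ (loopY j) σ)
  ok : _ → Bool
  ok (edge a b) = okX a σ ∧ okY b σ
  ok _          = true

-- condition (ii) (noncrossing): edges {x_s1,y_t1},{x_s2,y_t2} in σ with
-- s1<s2 have t1≤t2 (the strict version t1<t2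
-- printed in the context makes the theorem false already for m=n=1)
condII : ∀ {m n} → List (Vertex m n) → Bool
condII σ = all (λ e → all (pairOK e) σ) σ
  where
  pairOK : _ → _ → Bool
  pairOK (edge s₁ t₁) (edge s₂ t₂) =
    not (toℕ s₁ <ᵇ toℕ s₂) ∨ not (toℕ t₂ <ᵇ toℕ t₁)
  pairOK _ _ = true

isFace : ∀ {m n} → List (Vertex m n) → Bool
isFace σ = condI σ ∧ condII σ

faces : (m n : ℕ) → List (List (Vertex m n))
faces m n = filterᵇ isFace (sublists (vertices m n))

Ftri : (m n : ℕ) → ℚ → ℚ → ℚ
Ftri m n q t =
  sumℚ (map (λ σ → pow q (countᵇ isEdge σ) ℚ.* pow t (countᵇ isLoop σ)) (faces m n))

{-# OPTIONS --safe #-}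
-- Put T = t + 1 and s = q + T, and let G be given by G(m,0) = s^m, G(0,n) = s^n and
--   G(m+1,n+1) = s (G(m,n+1) + G(m+1,n)) + (q (q+1) - s²) G(m,n).
-- Both sides equal G(m,n).
--
-- A shuffle word u has one lower cover for each x_i missing from u (insert x_i right
-- before the next larger x, or at the end), one for each y not followed by an x
-- (delete it), and one for each factor yx (turn it into xy); only the last kind keeps
-- the letters.  Hence in the rescaled H-triangle a missing x, a y not followed by an x
-- and a y followed by an x weigh T, T and q + 1, a present x and a missing y weigh q,
-- and the recursion comes from splitting words by their first letter.
--
-- On the other side, after fixing the loops a face is a chain for the product order on
-- the remaining cells, the corner (x_0, y_0) excluded; a chain strictly above the corner
-- avoids the first row or the first column, and inclusion–exclusion gives the recursion.
module Submission where

open import Defs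
open import Data.Nat using (ℕ; zero; suc; _+_)
import Data.Nat as ℕ
import Data.Nat.Properties as ℕₚ
open import Data.Fin as Fin using (Fin; toℕ)
import Data.Fin.Properties as Finₚ
open import Data.Bool using (Bool; true; false; T; T?; if_then_else_; not; _∧_; _∨_)
import Data.Bool.Properties as Boolₚ
open import Data.Bool.Properties using (T-∧)
open import Data.Bool.ListAction using (all; any)
open import Data.Unit using (⊤; tt)
open import Data.Empty using (⊥; ⊥-elim)
open import Data.Product using (Σ; ∃; _×_; _,_; proj₁; proj₂; uncurry)
open import Data.Sum using (_⊎_; inj₁; inj₂; [_,_]′)
open import Data.List using (List; []; _∷_; _++_; map; concatMap; length; filter; filterᵇ; tabulate; allFin)
import Data.List.Properties as Listₚ
open import Data.List.Membership.Propositional using (_∈_; _∉_)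
open import Data.List.Membership.Propositional.Properties
open import Data.List.Membership.Propositional.Properties.WithK using (unique∧set⇒bag)
open import Data.List.Relation.Binary.BagAndSetEquality using (∼bag⇒↭)
open import Data.List.Relation.Binary.Permutation.Propositional using (_↭_)
import Data.List.Relation.Binary.Permutation.Propositional as Perm
open import Data.List.Relation.Binary.Permutation.Propositional.Properties using (↭-length)
open import Data.List.Relation.Unary.Any using (here; there; any?)
open import Data.List.Relation.Unary.All as All using (All; []; _∷_)
import Data.List.Relation.Unary.All.Properties as Allₚ
open import Data.List.Relation.Unary.AllPairs as AllPairs using (AllPairs; []; _∷_)
import Data.List.Relation.Unary.AllPairs.Properties as AllPairsₚ
open import Data.List.Relation.Unary.Linked using (Linked; []; [-]; _∷_)
import Data.List.Relation.Unary.Linked.Properties as Linkedₚ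
open import Data.List.Relation.Unary.Unique.Propositional using (Unique)
import Data.List.Relation.Unary.Unique.Propositional.Properties as Uniqueₚ
import Data.Rational as ℚ
open import Data.Rational using (ℚ; 0ℚ; 1ℚ; _*_; _-_; _÷_; ≢-nonZero)
import Data.Rational.Properties as ℚₚ
open import Data.Rational.Solver using (module +-*-Solver)
open import Function using (_∘_; Equivalence; mk⇔)
open import Relation.Nullary using (¬_; Dec; yes; no; ¬?; contradiction)
open import Relation.Nullary.Decidable using (map′)
open import Relation.Binary.Construct.Closure.ReflexiveTransitive using (ε; _◅_)
open import Relation.Binary.PropositionalEquality
  using (_≡_; _≢_; refl; sym; cong; cong₂; subst)
  renaming (trans to ≡-trans)

private variable
  m n : ℕ
  A B : Set

-- Shuffle words and lower covers

unique-set⇒↭ : {A : Set} {xs ys : List A} → Unique xs → Unique ys →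
  (∀ {z} → z ∈ xs → z ∈ ys) → (∀ {z} → z ∈ ys → z ∈ xs) → xs ↭ ys
unique-set⇒↭ ux uy f g = ∼bag⇒↭ (unique∧set⇒bag ux uy (mk⇔ f g))

infix 4 _≺_ _≟ᴸ_ _∈?_ _⊑_

_≺_ : Letter m n → Letter m n → Set
xl i ≺ xl k = i Fin.< k
yl j ≺ yl k = j Fin.< k
xl _ ≺ yl _ = ⊤
yl _ ≺ xl _ = ⊤

Sorted : Word m n → Set
Sorted = AllPairs _≺_

≺-irrefl : (a : Letter m n) → ¬ a ≺ a
≺-irrefl (xl i) = ℕₚ.<-irrefl refl
≺-irrefl (yl j) = ℕₚ.<-irrefl refl

incr⇒Linked : ∀ as → T (incr as) → Linked ℕ._<_ as
incr⇒Linked []           _ = []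
incr⇒Linked (a ∷ [])     _ = [-]
incr⇒Linked (a ∷ b ∷ as) h =
  let a<b , h′ = Equivalence.to (T-∧ {a ℕ.<ᵇ b}) h in ℕₚ.<ᵇ⇒< a b a<b ∷ incr⇒Linked (b ∷ as) h′

Linked⇒incr : ∀ {as} → Linked ℕ._<_ as → T (incr as)
Linked⇒incr []            = tt
Linked⇒incr [-]           = tt
Linked⇒incr (a<b ∷ rest) = Equivalence.from T-∧ (ℕₚ.<⇒<ᵇ a<b , Linked⇒incr rest)

isShuf⇒Sorted : (w : Word m n) → T (isShuf w) → Sorted w
isShuf⇒Sorted w h with Equivalence.to (T-∧ {incr (xIdx w)}) h
... | hx , hy = go w (Linkedₚ.Linked⇒AllPairs ℕₚ.<-trans (incr⇒Linked _ hx))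
                     (Linkedₚ.Linked⇒AllPairs ℕₚ.<-trans (incr⇒Linked _ hy))
  where
  allX : ∀ {i} w → All (toℕ i ℕ.<_) (xIdx w) → All (xl i ≺_) w
  allX []         _        = []
  allX (xl k ∷ w) (p ∷ ps) = p ∷ allX w ps
  allX (yl k ∷ w) ps       = tt ∷ allX w ps
  allY : ∀ {j} w → All (toℕ j ℕ.<_) (yIdx w) → All (yl j ≺_) w
  allY []         _        = []
  allY (xl k ∷ w) ps       = tt ∷ allY w ps
  allY (yl k ∷ w) (p ∷ ps) = p ∷ allY w ps
  go : ∀ w → AllPairs ℕ._<_ (xIdx w) → AllPairs ℕ._<_ (yIdx w) → Sorted w
  go []         _        _        = []
  go (xl i ∷ w) (p ∷ px) py       = allX w p ∷ go w px py
  go (yl j ∷ w) px       (p ∷ py) = allY w p ∷ go w px py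

Sorted⇒isShuf : {w : Word m n} → Sorted w → T (isShuf w)
Sorted⇒isShuf s = Equivalence.from T-∧
  (Linked⇒incr (Linkedₚ.AllPairs⇒Linked (xs s)) , Linked⇒incr (Linkedₚ.AllPairs⇒Linked (ys s)))
  where
  allX : ∀ {i} {w : Word _ _} → All (xl i ≺_) w → All (toℕ i ℕ.<_) (xIdx w)
  allX []                     = []
  allX {w = xl _ ∷ _} (p ∷ ps) = p ∷ allX ps
  allX {w = yl _ ∷ _} (p ∷ ps) = allX ps
  allY : ∀ {j} {w : Word _ _} → All (yl j ≺_) w → All (toℕ j ℕ.<_) (yIdx w)
  allY []                     = []
  allY {w = xl _ ∷ _} (p ∷ ps) = allY ps
  allY {w = yl _ ∷ _} (p ∷ ps) = p ∷ allY ps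
  xs : ∀ {w} → Sorted w → AllPairs ℕ._<_ (xIdx w)
  xs []                     = []
  xs {w = xl _ ∷ _} (p ∷ s) = allX p ∷ xs s
  xs {w = yl _ ∷ _} (p ∷ s) = xs s
  ys : ∀ {w} → Sorted w → AllPairs ℕ._<_ (yIdx w)
  ys []                     = []
  ys {w = xl _ ∷ _} (p ∷ s) = ys s
  ys {w = yl _ ∷ _} (p ∷ s) = allY p ∷ ys s

_≟ᴸ_ : (a b : Letter m n) → Dec (a ≡ b)
xl i ≟ᴸ xl k = map′ (cong xl) (λ { refl → refl }) (i Fin.≟ k)
yl i ≟ᴸ yl k = map′ (cong yl) (λ { refl → refl }) (i Fin.≟ k)
xl _ ≟ᴸ yl _ = no λ ()
yl _ ≟ᴸ xl _ = no λ ()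

_∈?_ : (a : Letter m n) (w : Word m n) → Dec (a ∈ w)
a ∈? w = any? (a ≟ᴸ_) w

Sorted⇒Unique : {w : Word m n} → Sorted w → Unique w
Sorted⇒Unique = AllPairs.map λ { a≺b refl → ≺-irrefl _ a≺b }

head∉ : ∀ {l} {w : Word m n} → Sorted (l ∷ w) → l ∉ w
head∉ (l≺ ∷ _) l∈w = ≺-irrefl _ (All.lookup l≺ l∈w)

Bef : Letter m n → Letter m n → Word m n → Set
Bef a b []      = ⊥
Bef a b (c ∷ w) = (c ≡ a × b ∈ w) ⊎ Bef a b w

Bef⇒∈ˡ : ∀ {a b} (w : Word m n) → Bef a b w → a ∈ w
Bef⇒∈ˡ (c ∷ w) (inj₁ (refl , _)) = here refl
Bef⇒∈ˡ (c ∷ w) (inj₂ h)          = there (Bef⇒∈ˡ w h)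

Bef⇒∈ʳ : ∀ {a b} (w : Word m n) → Bef a b w → b ∈ w
Bef⇒∈ʳ (c ∷ w) (inj₁ (_ , h)) = there h
Bef⇒∈ʳ (c ∷ w) (inj₂ h)       = there (Bef⇒∈ʳ w h)

Bef⇒≺ : ∀ {a b} (w : Word m n) → Sorted w → Bef a b w → a ≺ b
Bef⇒≺ (c ∷ w) (p ∷ s) (inj₁ (refl , h)) = All.lookup p h
Bef⇒≺ (c ∷ w) (p ∷ s) (inj₂ h)          = Bef⇒≺ w s h

Bef-total : ∀ {a b} (w : Word m n) → a ≢ b → a ∈ w → b ∈ w → Bef a b w ⊎ Bef b a w
Bef-total (c ∷ w) a≢b (here refl) (here refl) = ⊥-elim (a≢b refl)
Bef-total (c ∷ w) a≢b (here refl) (there q)   = inj₁ (inj₁ (refl , q))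
Bef-total (c ∷ w) a≢b (there p)   (here refl) = inj₂ (inj₁ (refl , p))
Bef-total (c ∷ w) a≢b (there p)   (there q)   with Bef-total w a≢b p q
... | inj₁ h = inj₁ (inj₂ h)
... | inj₂ h = inj₂ (inj₂ h)

Bef-asym : ∀ {a b} (w : Word m n) → Sorted w → Bef a b w → ¬ Bef b a w
Bef-asym (c ∷ w) s (inj₁ (refl , p)) (inj₁ (refl , q)) = head∉ s p
Bef-asym (c ∷ w) s (inj₁ (refl , p)) (inj₂ h)          = head∉ s (Bef⇒∈ʳ w h)
Bef-asym (c ∷ w) s (inj₂ h)          (inj₁ (refl , q)) = head∉ s (Bef⇒∈ʳ w h)
Bef-asym (c ∷ w) (_ ∷ s) (inj₂ h)    (inj₂ h′)         = Bef-asym w s h h′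

Bef-trans : ∀ {a b c} (w : Word m n) → Sorted w → Bef a b w → Bef b c w → Bef a c w
Bef-trans (d ∷ w) s (inj₁ (refl , p)) (inj₁ (refl , q)) = inj₁ (refl , q)
Bef-trans (d ∷ w) s (inj₁ (refl , p)) (inj₂ h)          = inj₁ (refl , Bef⇒∈ʳ w h)
Bef-trans (d ∷ w) s (inj₂ h)          (inj₁ (refl , q)) = ⊥-elim (head∉ s (Bef⇒∈ʳ w h))
Bef-trans (d ∷ w) (_ ∷ s) (inj₂ h)    (inj₂ h′)         = inj₂ (Bef-trans w s h h′)

Bef-xx : ∀ {i k} (w : Word m n) → Sorted w → i Fin.< k → xl i ∈ w → xl k ∈ w → Bef (xl i) (xl k) w
Bef-xx w s i<k p q with Bef-total w (λ { refl → ℕₚ.<-irrefl refl i<k }) p q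
... | inj₁ h = h
... | inj₂ h = ⊥-elim (ℕₚ.<-asym i<k (Bef⇒≺ w s h))

Bef-yy : ∀ {i k} (w : Word m n) → Sorted w → i Fin.< k → yl i ∈ w → yl k ∈ w → Bef (yl i) (yl k) w
Bef-yy w s i<k p q with Bef-total w (λ { refl → ℕₚ.<-irrefl refl i<k }) p q
... | inj₁ h = h
... | inj₂ h = ⊥-elim (ℕₚ.<-asym i<k (Bef⇒≺ w s h))

-- A semantic order containing the bubble order, in which two words are
-- compared through their letters and the relative positions of pairs (x, y).
record _⊑_ (u v : Word m n) : Set where
  constructor mk⊑
  field
    ⊑X : ∀ i → xl i ∈ v → xl i ∈ u
    ⊑Y : ∀ j → yl j ∈ u → yl j ∈ v
    ⊑B : ∀ i j → xl i ∈ v → Bef (yl j) (xl i) u → Bef (yl j) (xl i) v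
open _⊑_

⊑-refl : {u : Word m n} → u ⊑ u
⊑-refl = mk⊑ (λ _ h → h) (λ _ h → h) (λ _ _ _ h → h)

⊑-trans : {u v w : Word m n} → u ⊑ v → v ⊑ w → u ⊑ w
⊑-trans p q = mk⊑ (λ i h → ⊑X p i (⊑X q i h)) (λ j h → ⊑Y q j (⊑Y p j h))
  (λ i j h b → ⊑B q i j h (⊑B p i j (⊑X q i h) b))

_∖_ : Word m n → Letter m n → Word m n
w ∖ l = filter (λ c → ¬? (c ≟ᴸ l)) w

∈-∖⁺ : ∀ {a l} {w : Word m n} → a ≢ l → a ∈ w → a ∈ w ∖ l
∈-∖⁺ a≢l a∈w = ∈-filter⁺ (λ c → ¬? (c ≟ᴸ _)) a∈w a≢l

∈-∖⁻ : ∀ {a} l {w : Word m n} → a ∈ w ∖ l → a ∈ w × a ≢ l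
∈-∖⁻ l h = ∈-filter⁻ (λ c → ¬? (c ≟ᴸ l)) h

Bef-∖⁺ : ∀ {a b l} (w : Word m n) → a ≢ l → b ≢ l → Bef a b w → Bef a b (w ∖ l)
Bef-∖⁺ {l = l} (c ∷ w) a≢l b≢l h with c ≟ᴸ l
Bef-∖⁺ (c ∷ w) a≢l b≢l (inj₁ (refl , p)) | yes refl = ⊥-elim (a≢l refl)
Bef-∖⁺ (c ∷ w) a≢l b≢l (inj₂ h)          | yes refl = Bef-∖⁺ w a≢l b≢l h
Bef-∖⁺ (c ∷ w) a≢l b≢l (inj₁ (refl , p)) | no _     = inj₁ (refl , ∈-∖⁺ b≢l p)
Bef-∖⁺ (c ∷ w) a≢l b≢l (inj₂ h)          | no _     = inj₂ (Bef-∖⁺ w a≢l b≢l h)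

Bef-∖⁻ : ∀ {a b} l (w : Word m n) → Bef a b (w ∖ l) → Bef a b w
Bef-∖⁻ l (c ∷ w) h with c ≟ᴸ l
Bef-∖⁻ l (c ∷ w) h                 | yes _ = inj₂ (Bef-∖⁻ l w h)
Bef-∖⁻ l (c ∷ w) (inj₁ (refl , p)) | no _  = inj₁ (refl , proj₁ (∈-∖⁻ l p))
Bef-∖⁻ l (c ∷ w) (inj₂ h)          | no _  = inj₂ (Bef-∖⁻ l w h)

∖-mono : ∀ {u v : Word m n} l → u ⊑ v → (u ∖ l) ⊑ (v ∖ l)
∖-mono {u = u} {v} l p = mk⊑
  (λ i h → let h₁ , h₂ = ∈-∖⁻ l h in ∈-∖⁺ h₂ (⊑X p i h₁))
  (λ j h → let h₁ , h₂ = ∈-∖⁻ l h in ∈-∖⁺ h₂ (⊑Y p j h₁))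
  (λ i j h b → let h₁ , h₂ = ∈-∖⁻ l h in
    Bef-∖⁺ v (proj₂ (∈-∖⁻ l {u} (Bef⇒∈ˡ (u ∖ l) b))) h₂ (⊑B p i j h₁ (Bef-∖⁻ l u b)))

∖-∉ : ∀ {l} {w : Word m n} → l ∉ w → w ∖ l ≡ w
∖-∉ {l = l} l∉w = Listₚ.filter-all (λ c → ¬? (c ≟ᴸ l)) (All.tabulate λ { c∈w refl → l∉w c∈w })

∖-head : ∀ {l} {w : Word m n} → l ∉ w → (l ∷ w) ∖ l ≡ w
∖-head {l = l} l∉w = ≡-trans (Listₚ.filter-reject (λ c → ¬? (c ≟ᴸ l)) (λ h → h refl)) (∖-∉ l∉w)

∖-Sorted : ∀ {w : Word m n} l → Sorted w → Sorted (w ∖ l)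
∖-Sorted l = AllPairsₚ.filter⁺ (λ c → ¬? (c ≟ᴸ l))

first⇒head : ∀ {l} (w : Word m n) → Sorted w → l ∈ w → (∀ a → ¬ Bef a l w) → w ≡ l ∷ (w ∖ l)
first⇒head (c ∷ w) s (here refl) none = cong (c ∷_) (sym (∖-head (head∉ s)))
first⇒head (c ∷ w) s (there p)   none = ⊥-elim (none c (inj₁ (refl , p)))

∉-smaller-x : ∀ {i k} {w : Word m n} → Sorted (xl i ∷ w) → k Fin.< i → xl k ∉ xl i ∷ w
∉-smaller-x (p ∷ _) k<i (here refl) = ℕₚ.<-irrefl refl k<i
∉-smaller-x (p ∷ _) k<i (there h)   = ℕₚ.<-asym k<i (All.lookup p h)

∉-smaller-y : ∀ {i k} {w : Word m n} → Sorted (yl i ∷ w) → k Fin.< i → yl k ∉ yl i ∷ w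
∉-smaller-y (p ∷ _) k<i (here refl) = ℕₚ.<-irrefl refl k<i
∉-smaller-y (p ∷ _) k<i (there h)   = ℕₚ.<-asym k<i (All.lookup p h)

common-head : ∀ l {u v w : Word m n} → Sorted (l ∷ v) → Sorted (l ∷ u) → Sorted w →
  (l ∷ v) ⊑ w → w ⊑ (l ∷ u) → w ≡ l ∷ (w ∖ l)
common-head (xl i) {u} {v} {w} sv su sw p q = first⇒head w sw (⊑X q i (here refl)) λ where
    (xl k) h → ∉-smaller-x sv (Bef⇒≺ w sw h) (⊑X p k (Bef⇒∈ˡ w h))
    (yl j) h → [ (λ ()) , (λ b → head∉ su (Bef⇒∈ʳ u b)) ]′ (⊑B q i j (here refl) h)
common-head (yl j) {u} {v} {w} sv su sw p q = first⇒head w sw (⊑Y p j (here refl)) λ where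
    (yl k) h → ∉-smaller-y su (Bef⇒≺ w sw h) (⊑Y q k (Bef⇒∈ˡ w h))
    (xl i) h → let i∈w = Bef⇒∈ˡ w h in
      case-v (⊑X p i i∈w) λ i∈v → Bef-asym w sw h (⊑B p i j i∈w (inj₁ (refl , i∈v)))
  where
  case-v : ∀ {i} → xl i ∈ yl j ∷ v → (xl i ∈ v → ⊥) → ⊥
  case-v (there h) k = k h

strip : ∀ l {u v w : Word m n} → Sorted (l ∷ v) → Sorted (l ∷ u) →
  (l ∷ v) ⊑ w → w ⊑ (l ∷ u) → v ⊑ (w ∖ l) × (w ∖ l) ⊑ u
strip l {w = w} sv su p q =
  subst (_⊑ (w ∖ l)) (∖-head (head∉ sv)) (∖-mono l p) , subst ((w ∖ l) ⊑_) (∖-head (head∉ su)) (∖-mono l q)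

⊑-antisym : {u w : Word m n} → Sorted u → Sorted w → u ⊑ w → w ⊑ u → w ≡ u
⊑-antisym {u = []} {[]} _ _ _ _ = refl
⊑-antisym {u = []} {xl i ∷ w} _ _ p q with ⊑X p i (here refl)
... | ()
⊑-antisym {u = []} {yl j ∷ w} _ _ p q with ⊑Y q j (here refl)
... | ()
⊑-antisym {u = l ∷ u} {w} su@(_ ∷ su′) sw p q = let p′ , q′ = strip l su su p q in
  ≡-trans (common-head l su su sw p q) (cong (l ∷_) (⊑-antisym su′ (∖-Sorted l sw) p′ q′))

data Kind : Set where
  ins del swap : Kind

data Low {m n : ℕ} : Kind → Word m n → Word m n → Set where
  ins-end : ∀ {i} → Low ins [] (xl i ∷ [])
  ins-x   : ∀ {i k s} → Low ins (xl k ∷ s) (xl i ∷ xl k ∷ s)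
  del-end : ∀ {j} → Low del (yl j ∷ []) []
  del-y   : ∀ {j k s} → Low del (yl j ∷ yl k ∷ s) (yl k ∷ s)
  swap-yx : ∀ {i j s} → Low swap (yl j ∷ xl i ∷ s) (xl i ∷ yl j ∷ s)
  _∷_     : ∀ {κ u v} l → Low κ u v → Low κ (l ∷ u) (l ∷ v)

low-++ : ∀ {κ} p {u v : Word m n} → Low κ u v → Low κ (p ++ u) (p ++ v)
low-++ []      h = h
low-++ (l ∷ p) h = l ∷ low-++ p h

∖-sandwich : ∀ l {u v w s : Word m n} → Sorted w → Sorted s → v ∖ l ≡ s → u ∖ l ≡ s →
  v ⊑ w → w ⊑ u → w ∖ l ≡ s
∖-sandwich l {w = w} sw ss ev eu p q = ⊑-antisym ss (∖-Sorted l sw)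
  (subst (_⊑ (w ∖ l)) ev (∖-mono l p)) (subst ((w ∖ l) ⊑_) eu (∖-mono l q))

-- The comparison with a neighbour of the moved letter pins down its position in w.
low-sandwich : ∀ {κ} {u v w : Word m n} → Low κ u v → Sorted u → Sorted v → Sorted w →
  v ⊑ w → w ⊑ u → w ≡ v ⊎ w ≡ u
low-sandwich {u = u} {v} {w} (ins-end {i}) su sv sw p q with xl i ∈? w
... | no i∉ = inj₂ (≡-trans (sym (∖-∉ i∉)) (∖-sandwich (xl i) sw su (∖-head (head∉ sv)) refl p q))
... | yes i∈ = inj₁ (≡-trans
    (first⇒head w sw i∈ λ where
      (xl k) h → ∉-smaller-x sv (Bef⇒≺ w sw h) (⊑X p k (Bef⇒∈ˡ w h))
      (yl j) h → none (⊑Y q j (Bef⇒∈ˡ w h)))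
    (cong (xl i ∷_) (∖-sandwich (xl i) sw su (∖-head (head∉ sv)) refl p q)))
  where
  none : ∀ {a : Letter _ _} → a ∈ [] → ⊥
  none ()
low-sandwich {w = w} (ins-x {i} {k} {s}) su sv sw p q with xl i ∈? w
... | no i∉ = inj₂ (≡-trans (sym (∖-∉ i∉))
    (∖-sandwich (xl i) sw su (∖-head (head∉ sv)) (∖-∉ (head∉ sv)) p q))
... | yes i∈ = inj₁ (≡-trans
    (first⇒head w sw i∈ λ where
      (xl h) b → ∉-smaller-x sv (Bef⇒≺ w sw b) (⊑X p h (Bef⇒∈ˡ w b))
      (yl j) b → [ (λ ()) , (λ c → head∉ su (Bef⇒∈ʳ s c)) ]′
        (⊑B q k j (here refl)
          (Bef-trans w sw b (Bef-xx w sw (All.head (AllPairs.head sv)) i∈ (⊑X q k (here refl))))))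
    (cong (xl i ∷_) (∖-sandwich (xl i) sw su (∖-head (head∉ sv)) (∖-∉ (head∉ sv)) p q)))
low-sandwich {w = w} (del-end {j}) su sv sw p q with yl j ∈? w
... | no j∉ = inj₁ (≡-trans (sym (∖-∉ j∉)) (∖-sandwich (yl j) sw sv refl (∖-head (head∉ su)) p q))
... | yes j∈ = inj₂ (≡-trans
    (first⇒head w sw j∈ λ where
      (yl k) h → ∉-smaller-y su (Bef⇒≺ w sw h) (⊑Y q k (Bef⇒∈ˡ w h))
      (xl i) h → none (⊑X p i (Bef⇒∈ˡ w h)))
    (cong (yl j ∷_) (∖-sandwich (yl j) sw sv refl (∖-head (head∉ su)) p q)))
  where
  none : ∀ {a : Letter _ _} → a ∈ [] → ⊥
  none ()
low-sandwich {w = w} (del-y {j} {k} {s}) su sv sw p q with yl j ∈? w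
... | no j∉ = inj₁ (≡-trans (sym (∖-∉ j∉))
    (∖-sandwich (yl j) sw sv (∖-∉ (head∉ su)) (∖-head (head∉ su)) p q))
... | yes j∈ = inj₂ (≡-trans
    (first⇒head w sw j∈ λ where
      (yl h) b → ∉-smaller-y su (Bef⇒≺ w sw b) (⊑Y q h (Bef⇒∈ˡ w b))
      (xl i) b → let i∈w = Bef⇒∈ˡ w b in
        Bef-asym w sw b
          (Bef-trans w sw (Bef-yy w sw (All.head (AllPairs.head su)) j∈ (⊑Y p k (here refl)))
            (⊑B p i k i∈w (inj₁ (refl , tail (⊑X p i i∈w))))))
    (cong (yl j ∷_) (∖-sandwich (yl j) sw sv (∖-∉ (head∉ su)) (∖-head (head∉ su)) p q)))
  where
  tail : ∀ {i} → xl i ∈ yl k ∷ s → xl i ∈ s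
  tail (there h) = h
low-sandwich {w = w} (swap-yx {i} {j} {s}) su@(j≺ ∷ i≺ ∷ ss) sv@(i≺′ ∷ j≺′ ∷ _) sw p q
  with Bef-total {a = xl i} {yl j} w (λ ()) (⊑X q i (there (here refl))) (⊑Y p j (there (here refl)))
... | inj₁ x<y = inj₁ (≡-trans
    (first⇒head w sw (Bef⇒∈ˡ w x<y) λ where
      (xl k) b → ∉-smaller-x sv (Bef⇒≺ w sw b) (⊑X p k (Bef⇒∈ˡ w b))
      (yl k) b → y-first b (⊑B q i k (there (here refl)) b))
    (cong (xl i ∷_) (∖-sandwich (xl i) sw (AllPairs.tail sv) (∖-head (head∉ sv))
      (cong (yl j ∷_) (∖-head (head∉ (i≺ ∷ ss)))) p q)))
  where
  y-first : ∀ {k} → Bef (yl k) (xl i) w → ¬ Bef (yl k) (xl i) (yl j ∷ xl i ∷ s)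
  y-first b (inj₁ (refl , _)) = Bef-asym w sw x<y b
  y-first b (inj₂ (inj₂ c))   = head∉ (i≺ ∷ ss) (Bef⇒∈ʳ s c)
... | inj₂ y<x = inj₂ (≡-trans
    (first⇒head w sw (Bef⇒∈ˡ w y<x) λ where
      (yl k) b → ∉-smaller-y su (Bef⇒≺ w sw b) (⊑Y q k (Bef⇒∈ˡ w b))
      (xl k) b → x-late b (⊑X p k (Bef⇒∈ˡ w b)))
    (cong (yl j ∷_) (∖-sandwich (yl j) sw (AllPairs.tail su)
      (cong (xl i ∷_) (∖-head (head∉ (AllPairs.tail sv)))) (∖-head (head∉ su)) p q)))
  where
  x-late : ∀ {k} → Bef (xl k) (yl j) w → xl k ∉ xl i ∷ yl j ∷ s
  x-late b (here refl)         = Bef-asym w sw b y<x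
  x-late b (there (there k∈s)) =
    Bef-asym w sw b (⊑B p _ j (Bef⇒∈ˡ w b) (inj₂ (inj₁ (refl , k∈s))))
low-sandwich (l ∷ h) su sv sw p q
  with p′ , q′ ← strip l sv su p q
  with low-sandwich h (AllPairs.tail su) (AllPairs.tail sv) (∖-Sorted l sw) p′ q′
... | inj₁ e = inj₁ (≡-trans (common-head l sv su sw p q) (cong (l ∷_) e))
... | inj₂ e = inj₂ (≡-trans (common-head l sv su sw p q) (cong (l ∷_) e))

∈-drop-mid : ∀ {a c : Letter m n} p {s} → a ∈ p ++ s → a ∈ p ++ c ∷ s
∈-drop-mid p h = [ ∈-++⁺ˡ , ∈-++⁺ʳ p ∘ there ]′ (∈-++⁻ p h)

∈-mid⁻ : ∀ {a c : Letter m n} p {s} → a ≢ c → a ∈ p ++ c ∷ s → a ∈ p ++ s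
∈-mid⁻ p a≢c h with ∈-++⁻ p h
... | inj₁ q         = ∈-++⁺ˡ q
... | inj₂ (here e)  = ⊥-elim (a≢c e)
... | inj₂ (there q) = ∈-++⁺ʳ p q

∈-swap : ∀ {a c d : Letter m n} p {s} → a ∈ p ++ c ∷ d ∷ s → a ∈ p ++ d ∷ c ∷ s
∈-swap p h with ∈-++⁻ p h
... | inj₁ q                 = ∈-++⁺ˡ q
... | inj₂ (here e)          = ∈-++⁺ʳ p (there (here e))
... | inj₂ (there (here e))  = ∈-++⁺ʳ p (here e)
... | inj₂ (there (there q)) = ∈-++⁺ʳ p (there (there q))

mid∉ : ∀ {c : Letter m n} p {s} → Sorted (p ++ c ∷ s) → c ∉ p ++ s
mid∉ []      s             = head∉ s
mid∉ (a ∷ p) (a≺ ∷ s) (here refl) = ≺-irrefl _ (All.lookup a≺ (∈-++⁺ʳ p (here refl)))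
mid∉ (a ∷ p) (a≺ ∷ s) (there h)   = mid∉ p s h

Bef-mid⁺ : ∀ {a b c : Letter m n} p {s} → Bef a b (p ++ s) → Bef a b (p ++ c ∷ s)
Bef-mid⁺ []      h              = inj₂ h
Bef-mid⁺ (d ∷ p) (inj₁ (e , h)) = inj₁ (e , ∈-drop-mid p h)
Bef-mid⁺ (d ∷ p) (inj₂ h)       = inj₂ (Bef-mid⁺ p h)

Bef-mid⁻ : ∀ {a b c : Letter m n} p {s} → a ≢ c → b ≢ c → Bef a b (p ++ c ∷ s) → Bef a b (p ++ s)
Bef-mid⁻ []      a≢c b≢c (inj₁ (e , h)) = ⊥-elim (a≢c (sym e))
Bef-mid⁻ []      a≢c b≢c (inj₂ h)       = h
Bef-mid⁻ (d ∷ p) a≢c b≢c (inj₁ (e , h)) = inj₁ (e , ∈-mid⁻ p b≢c h)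
Bef-mid⁻ (d ∷ p) a≢c b≢c (inj₂ h)       = inj₂ (Bef-mid⁻ p a≢c b≢c h)

Bef-swap : ∀ {i j k l} (p : Word m n) {s} →
  Bef (yl j) (xl i) (p ++ xl k ∷ yl l ∷ s) → Bef (yl j) (xl i) (p ++ yl l ∷ xl k ∷ s)
Bef-swap []      (inj₂ (inj₁ (e , h))) = inj₁ (e , there h)
Bef-swap []      (inj₂ (inj₂ h))       = inj₂ (inj₂ h)
Bef-swap (d ∷ p) (inj₁ (e , h))        = inj₁ (e , ∈-swap p h)
Bef-swap (d ∷ p) (inj₂ h)              = inj₂ (Bef-swap p h)

Step⇒⊑ : {u v : Word m n} → Step u v → u ⊑ v
Step⇒⊑ (delX p s i su sv) = mk⊑ (λ _ → ∈-drop-mid p) (λ _ → ∈-mid⁻ p λ ())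
  (λ k j h → Bef-mid⁻ p (λ ()) λ { refl → mid∉ p (isShuf⇒Sorted _ su) h })
Step⇒⊑ (insY p s j su sv) = mk⊑ (λ _ → ∈-mid⁻ p λ ()) (λ _ → ∈-drop-mid p) (λ _ _ _ → Bef-mid⁺ p)
Step⇒⊑ (trans p s i j su sv) = mk⊑ (λ _ → ∈-swap p) (λ _ → ∈-swap p) (λ _ _ _ → Bef-swap p)

≤B⇒⊑ : {u v : Word m n} → u ≤B v → u ⊑ v
≤B⇒⊑ ε        = ⊑-refl
≤B⇒⊑ (s ◅ ss) = ⊑-trans (Step⇒⊑ s) (≤B⇒⊑ ss)

Step⇒isShufʳ : {u v : Word m n} → Step u v → T (isShuf v)
Step⇒isShufʳ (delX p s i su sv)    = sv
Step⇒isShufʳ (insY p s j su sv)    = sv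
Step⇒isShufʳ (trans p s i j su sv) = sv

≤B⇒isShuf : {u v : Word m n} → T (isShuf u) → u ≤B v → T (isShuf v)
≤B⇒isShuf hu ε        = hu
≤B⇒isShuf hu (s ◅ ss) = ≤B⇒isShuf (Step⇒isShufʳ s) ss

length-mid : ∀ {c : Letter m n} p {s} → length (p ++ c ∷ s) ≡ suc (length (p ++ s))
length-mid []      = refl
length-mid (_ ∷ p) = cong suc (length-mid p)

Step-irrefl : {u v : Word m n} → Step u v → u ≢ v
Step-irrefl (delX p s i _ _) e = ℕₚ.1+n≢n (≡-trans (sym (length-mid p)) (cong length e))
Step-irrefl (insY p s j _ _) e = ℕₚ.1+n≢n (≡-trans (sym (length-mid p)) (cong length (sym e)))
Step-irrefl (trans p s i j _ _) e with Listₚ.++-cancelˡ p _ _ e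
... | ()

Step-∷ : ∀ l {u v : Word m n} → Sorted (l ∷ u) → Sorted (l ∷ v) → Step u v → Step (l ∷ u) (l ∷ v)
Step-∷ l su sv (delX p s i _ _)    = delX (l ∷ p) s i (Sorted⇒isShuf su) (Sorted⇒isShuf sv)
Step-∷ l su sv (insY p s j _ _)    = insY (l ∷ p) s j (Sorted⇒isShuf su) (Sorted⇒isShuf sv)
Step-∷ l su sv (trans p s i j _ _) = trans (l ∷ p) s i j (Sorted⇒isShuf su) (Sorted⇒isShuf sv)

low⇒Step : ∀ {κ} {u v : Word m n} → Sorted u → Sorted v → Low κ u v → Step v u
low⇒Step su sv ins-end = delX [] _ _ (Sorted⇒isShuf sv) (Sorted⇒isShuf su)
low⇒Step su sv ins-x   = delX [] _ _ (Sorted⇒isShuf sv) (Sorted⇒isShuf su)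
low⇒Step su sv del-end = insY [] _ _ (Sorted⇒isShuf sv) (Sorted⇒isShuf su)
low⇒Step su sv del-y   = insY [] _ _ (Sorted⇒isShuf sv) (Sorted⇒isShuf su)
low⇒Step su sv swap-yx = trans [] _ _ _ (Sorted⇒isShuf sv) (Sorted⇒isShuf su)
low⇒Step su sv (l ∷ h) = Step-∷ l sv su (low⇒Step (AllPairs.tail su) (AllPairs.tail sv) h)

low⇒CoveredBy : ∀ {κ} {u v : Word m n} → Sorted u → Sorted v → Low κ u v → CoveredBy u v
low⇒CoveredBy {u = u} {v} su sv h = hv , (step ◅ ε , Step-irrefl step) , nothing-between
  where
  step = low⇒Step su sv h
  hv = Sorted⇒isShuf sv
  nothing-between : ¬ (Σ _ λ w → v <B w × w <B u)
  nothing-between (w , (v≤w , v≢w) , (w≤u , w≢u))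
    with low-sandwich h su sv (isShuf⇒Sorted w (≤B⇒isShuf hv v≤w)) (≤B⇒⊑ v≤w) (≤B⇒⊑ w≤u)
  ... | inj₁ e = v≢w (sym e)
  ... | inj₂ e = w≢u e

swap-mid-Sorted : ∀ p {c d} {s : Word m n} → d ≺ c → Sorted (p ++ c ∷ d ∷ s) → Sorted (p ++ d ∷ c ∷ s)
swap-mid-Sorted []      d≺c ((_ ∷ c≺) ∷ d≺ ∷ h) = (d≺c ∷ d≺) ∷ c≺ ∷ h
swap-mid-Sorted (l ∷ p) d≺c (l≺ ∷ h) = All.tabulate (All.lookup l≺ ∘ ∈-swap p) ∷ swap-mid-Sorted p d≺c h

delX-≡ : ∀ (p s : Word m n) i {v u} → p ++ xl i ∷ s ≡ v → p ++ s ≡ u →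
  T (isShuf v) → T (isShuf u) → Step v u
delX-≡ p s i refl refl = delX p s i

insY-≡ : ∀ (p s : Word m n) j {v u} → p ++ s ≡ v → p ++ yl j ∷ s ≡ u →
  T (isShuf v) → T (isShuf u) → Step v u
insY-≡ p s j refl refl = insY p s j

-- In the excluded configurations, where a letter is followed by one of the
-- other alphabet, the move factors through a transposition.
coverStep⇒low : {u v : Word m n} → Step v u → ¬ (Σ _ λ w → Step v w × Step w u) → ∃ λ κ → Low κ u v
coverStep⇒low (delX p [] i sv su) none = ins , low-++ p ins-end
coverStep⇒low (delX p (xl k ∷ s) i sv su) none = ins , low-++ p ins-x
coverStep⇒low (delX p (yl j ∷ s) i sv su) none = ⊥-elim (none (p ++ yl j ∷ xl i ∷ s ,
  trans p s i j sv sw , delX-≡ (p ++ yl j ∷ []) s i (Listₚ.++-assoc p _ _) (Listₚ.++-assoc p _ _) sw su))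
  where sw = Sorted⇒isShuf (swap-mid-Sorted p tt (isShuf⇒Sorted _ sv))
coverStep⇒low (insY p [] j sv su) none = del , low-++ p del-end
coverStep⇒low (insY p (yl k ∷ s) j sv su) none = del , low-++ p del-y
coverStep⇒low (insY p (xl i ∷ s) j sv su) none = ⊥-elim (none (p ++ xl i ∷ yl j ∷ s ,
  insY-≡ (p ++ xl i ∷ []) s j (Listₚ.++-assoc p _ _) (Listₚ.++-assoc p _ _) sv sw , trans p s i j sw su))
  where sw = Sorted⇒isShuf (swap-mid-Sorted p tt (isShuf⇒Sorted _ su))
coverStep⇒low (trans p s i j sv su) none = swap , low-++ p swap-yx

_≟ᵂ_ : (u v : Word m n) → Dec (u ≡ v)
_≟ᵂ_ = Listₚ.≡-dec _≟ᴸ_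

CoveredBy⇒low : {u v : Word m n} → CoveredBy u v → ∃ λ κ → Low κ u v
CoveredBy⇒low (hv , (ε , v≢u) , none) = ⊥-elim (v≢u refl)
CoveredBy⇒low {u = u} (hv , (_◅_ {j = w} st rest , v≢u) , none) with w ≟ᵂ u
... | yes refl = coverStep⇒low st λ (w′ , a , b) →
  none (w′ , (a ◅ ε , Step-irrefl a) , (b ◅ ε , Step-irrefl b))
... | no w≢u = ⊥-elim (none (w , (st ◅ ε , Step-irrefl st) , (rest , w≢u)))

low-length : ∀ {κ} {u v : Word m n} → Low κ u v →
  (κ ≡ ins × length v ≡ suc (length u)) ⊎ (κ ≡ del × length u ≡ suc (length v)) ⊎ (κ ≡ swap × length v ≡ length u)
low-length ins-end = inj₁ (refl , refl)
low-length ins-x   = inj₁ (refl , refl)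
low-length del-end = inj₂ (inj₁ (refl , refl))
low-length del-y   = inj₂ (inj₁ (refl , refl))
low-length swap-yx = inj₂ (inj₂ (refl , refl))
low-length (l ∷ h) with low-length h
... | inj₁ (e , f)        = inj₁ (e , cong suc f)
... | inj₂ (inj₁ (e , f)) = inj₂ (inj₁ (e , cong suc f))
... | inj₂ (inj₂ (e , f)) = inj₂ (inj₂ (e , cong suc f))

low-kind : ∀ {κ κ′} {u v : Word m n} → Low κ u v → Low κ′ u v → κ ≡ κ′
low-kind h h′ with low-length h | low-length h′
... | inj₁ (refl , e)        | inj₁ (refl , f)        = refl
... | inj₁ (refl , e)        | inj₂ (inj₁ (refl , f)) = ⊥-elim (ℕₚ.m≢1+n+m _ (≡-trans f (cong suc e)))
... | inj₁ (refl , e)        | inj₂ (inj₂ (refl , f)) = ⊥-elim (ℕₚ.1+n≢n (≡-trans (sym e) f))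
... | inj₂ (inj₁ (refl , e)) | inj₁ (refl , f)        = ⊥-elim (ℕₚ.m≢1+n+m _ (≡-trans e (cong suc f)))
... | inj₂ (inj₁ (refl , e)) | inj₂ (inj₁ (refl , f)) = refl
... | inj₂ (inj₁ (refl , e)) | inj₂ (inj₂ (refl , f)) = ⊥-elim (ℕₚ.1+n≢n (≡-trans (sym e) (sym f)))
... | inj₂ (inj₂ (refl , e)) | inj₁ (refl , f)        = ⊥-elim (ℕₚ.1+n≢n (≡-trans (sym f) e))
... | inj₂ (inj₂ (refl , e)) | inj₂ (inj₁ (refl , f)) = ⊥-elim (ℕₚ.1+n≢n (≡-trans (sym f) (sym e)))
... | inj₂ (inj₂ (refl , e)) | inj₂ (inj₂ (refl , f)) = refl

SameLetters⇒length : {u v : Word m n} → Sorted u → Sorted v → SameLetters u v → length u ≡ length v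
SameLetters⇒length su sv h = ↭-length (unique-set⇒↭ (Sorted⇒Unique su) (Sorted⇒Unique sv)
  (proj₁ (h _)) (proj₂ (h _)))

low-swap⇒SameLetters : {u v : Word m n} → Low swap u v → SameLetters u v
low-swap⇒SameLetters swap-yx a = ∈-swap [] , ∈-swap []
low-swap⇒SameLetters (l ∷ h) a = go (proj₁ (low-swap⇒SameLetters h a)) , go (proj₂ (low-swap⇒SameLetters h a))
  where
  go : ∀ {w w′} → (a ∈ w → a ∈ w′) → a ∈ l ∷ w → a ∈ l ∷ w′
  go f (here e)  = here e
  go f (there h) = there (f h)

insX : Fin m → Word m n → Word m n
insX i []         = xl i ∷ []
insX i (yl j ∷ w) = yl j ∷ insX i w
insX i (xl k ∷ w) with i Fin.<? k
... | yes _ = xl i ∷ xl k ∷ w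
... | no  _ = xl k ∷ insX i w

xl-injective : ∀ {i k : Fin m} → xl {m} {n} i ≡ xl k → i ≡ k
xl-injective refl = refl

insX-injective : (w : Word m n) {i k : Fin m} → insX i w ≡ insX k w → i ≡ k
insX-injective []         refl = refl
insX-injective (yl j ∷ w) e    = insX-injective w (Listₚ.∷-injectiveʳ e)
insX-injective (xl h ∷ w) {i} {k} e with i Fin.<? h | k Fin.<? h | e
... | yes _   | yes _   | e′ = xl-injective (Listₚ.∷-injectiveˡ e′)
... | yes i<h | no _    | e′ = ⊥-elim (Finₚ.<-irrefl (xl-injective (Listₚ.∷-injectiveˡ e′)) i<h)
... | no _    | yes k<h | e′ = ⊥-elim (Finₚ.<-irrefl (xl-injective (Listₚ.∷-injectiveˡ (sym e′))) k<h)
... | no _    | no _    | e′ = insX-injective w (Listₚ.∷-injectiveʳ e′)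

insX-All : ∀ {P : Letter m n → Set} {i} {w} → P (xl i) → All P w → All P (insX i w)
insX-All p []                 = p ∷ []
insX-All {w = yl _ ∷ _} p (q ∷ qs) = q ∷ insX-All p qs
insX-All {i = i} {w = xl k ∷ _} p (q ∷ qs) with i Fin.<? k
... | yes _ = p ∷ q ∷ qs
... | no  _ = q ∷ insX-All p qs

insX-Sorted : ∀ {i} {w : Word m n} → xl i ∉ w → Sorted w → Sorted (insX i w)
insX-Sorted i∉ []                        = [] ∷ []
insX-Sorted {w = yl _ ∷ _} i∉ (l≺ ∷ s) = insX-All tt l≺ ∷ insX-Sorted (i∉ ∘ there) s
insX-Sorted {i = i} {w = xl k ∷ w} i∉ (k≺ ∷ s) with i Fin.<? k
... | yes i<k = (i<k ∷ All.map (λ {c} → below c) k≺) ∷ k≺ ∷ s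
  where
  below : ∀ c → xl k ≺ c → xl i ≺ c
  below (xl h) k<h = ℕₚ.<-trans i<k k<h
  below (yl h) _   = tt
... | no i≮k = insX-All (ℕₚ.≤∧≢⇒< (ℕₚ.≮⇒≥ i≮k) (λ e → i∉ (here (cong xl (sym (Finₚ.toℕ-injective e)))))) k≺
  ∷ insX-Sorted (i∉ ∘ there) s

insX-low : ∀ i (w : Word m n) → Low ins w (insX i w)
insX-low i []         = ins-end
insX-low i (yl j ∷ w) = yl j ∷ insX-low i w
insX-low i (xl k ∷ w) with i Fin.<? k
... | yes _ = ins-x
... | no  _ = xl k ∷ insX-low i w

low-insX : {u v : Word m n} → Sorted v → Low ins u v → ∃ λ i → xl i ∉ u × v ≡ insX i u
low-insX sv (ins-end {i}) = i , (λ ()) , refl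
low-insX sv@((i<k ∷ _) ∷ _) (ins-x {i} {k} {s}) = i , head∉ sv , eq
  where
  eq : xl i ∷ xl k ∷ s ≡ insX i (xl k ∷ s)
  eq with i Fin.<? k
  ... | yes _  = refl
  ... | no i≮k = ⊥-elim (i≮k i<k)
low-insX sv@(l≺ ∷ sv′) (l ∷ h) with low-insX sv′ h
low-insX sv (yl j ∷ h) | i , i∉ , refl = i , (λ { (there p) → i∉ p }) , refl
low-insX {v = xl k ∷ v} sv@(k≺ ∷ _) (_∷_ {u = u} (xl k) h) | i , i∉ , refl = i , notin , eq
  where
  i∈v : ∀ w → xl i ∈ insX i w
  i∈v []         = here refl
  i∈v (yl _ ∷ w) = there (i∈v w)
  i∈v (xl h ∷ w) with i Fin.<? h
  ... | yes _ = here refl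
  ... | no  _ = there (i∈v w)
  k<i : k Fin.< i
  k<i = All.lookup k≺ (i∈v u)
  notin : xl i ∉ xl k ∷ u
  notin (here refl) = ℕₚ.<-irrefl refl k<i
  notin (there p)   = i∉ p
  eq : xl k ∷ insX i u ≡ insX i (xl k ∷ u)
  eq with i Fin.<? k
  ... | yes i<k = ⊥-elim (ℕₚ.<-asym i<k k<i)
  ... | no _    = refl

absentX : Word m n → List (Fin m)
absentX w = filter (λ i → ¬? (xl i ∈? w)) (allFin _)

inserts dels swaps : Word m n → List (Word m n)
inserts w = map (λ i → insX i w) (absentX w)

dels []                = []
dels (xl i ∷ w)        = map (xl i ∷_) (dels w)
dels (yl j ∷ [])       = [] ∷ []
dels (yl j ∷ xl i ∷ w) = map (yl j ∷_) (dels (xl i ∷ w))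
dels (yl j ∷ yl k ∷ w) = (yl k ∷ w) ∷ map (yl j ∷_) (dels (yl k ∷ w))

swaps []                = []
swaps (xl i ∷ w)        = map (xl i ∷_) (swaps w)
swaps (yl j ∷ [])       = []
swaps (yl j ∷ xl i ∷ w) = (xl i ∷ yl j ∷ w) ∷ map (yl j ∷_) (swaps (xl i ∷ w))
swaps (yl j ∷ yl k ∷ w) = map (yl j ∷_) (swaps (yl k ∷ w))

dels⁺ : {u v : Word m n} → Low del u v → v ∈ dels u
dels⁺ del-end                       = here refl
dels⁺ del-y                         = here refl
dels⁺ (xl i ∷ h)                    = ∈-map⁺ (xl i ∷_) (dels⁺ h)
dels⁺ (_∷_ {u = []} (yl j) ())
dels⁺ (_∷_ {u = xl _ ∷ _} (yl j) h) = ∈-map⁺ (yl j ∷_) (dels⁺ h)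
dels⁺ (_∷_ {u = yl _ ∷ _} (yl j) h) = there (∈-map⁺ (yl j ∷_) (dels⁺ h))

swaps⁺ : {u v : Word m n} → Low swap u v → v ∈ swaps u
swaps⁺ swap-yx                       = here refl
swaps⁺ (xl i ∷ h)                    = ∈-map⁺ (xl i ∷_) (swaps⁺ h)
swaps⁺ (_∷_ {u = []} (yl j) ())
swaps⁺ (_∷_ {u = xl _ ∷ _} (yl j) h) = there (∈-map⁺ (yl j ∷_) (swaps⁺ h))
swaps⁺ (_∷_ {u = yl _ ∷ _} (yl j) h) = ∈-map⁺ (yl j ∷_) (swaps⁺ h)

map∷-low⁻ : ∀ {κ} l {u v : Word m n} {L} → (∀ {v} → v ∈ L → Low κ u v) → v ∈ map (l ∷_) L → Low κ (l ∷ u) v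
map∷-low⁻ l f h with ∈-map⁻ (l ∷_) h
... | _ , h′ , refl = l ∷ f h′

dels⁻ : (u : Word m n) {v : Word m n} → v ∈ dels u → Low del u v
dels⁻ (xl i ∷ w)        h           = map∷-low⁻ (xl i) (dels⁻ w) h
dels⁻ (yl j ∷ [])       (here refl) = del-end
dels⁻ (yl j ∷ xl i ∷ w) h           = map∷-low⁻ (yl j) (dels⁻ (xl i ∷ w)) h
dels⁻ (yl j ∷ yl k ∷ w) (here refl) = del-y
dels⁻ (yl j ∷ yl k ∷ w) (there h)   = map∷-low⁻ (yl j) (dels⁻ (yl k ∷ w)) h

swaps⁻ : (u : Word m n) {v : Word m n} → v ∈ swaps u → Low swap u v
swaps⁻ (xl i ∷ w)        h           = map∷-low⁻ (xl i) (swaps⁻ w) h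
swaps⁻ (yl j ∷ xl i ∷ w) (here refl) = swap-yx
swaps⁻ (yl j ∷ xl i ∷ w) (there h)   = map∷-low⁻ (yl j) (swaps⁻ (xl i ∷ w)) h
swaps⁻ (yl j ∷ yl k ∷ w) h           = map∷-low⁻ (yl j) (swaps⁻ (yl k ∷ w)) h

map∷-Unique : ∀ (l : Letter m n) {L} → Unique L → Unique (map (l ∷_) L)
map∷-Unique l = Uniqueₚ.map⁺ Listₚ.∷-injectiveʳ

∉-map∷ : {l c : Letter m n} {w : Word m n} {L : List (Word m n)} → c ≢ l → All ((c ∷ w) ≢_) (map (l ∷_) L)
∉-map∷ {L = []}    c≢l = []
∉-map∷ {L = _ ∷ _} c≢l = (c≢l ∘ Listₚ.∷-injectiveˡ) ∷ ∉-map∷ c≢l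

dels-Unique : {w : Word m n} → Sorted w → Unique (dels w)
dels-Unique {w = []}              _       = []
dels-Unique {w = xl i ∷ w}        (_ ∷ s) = map∷-Unique (xl i) (dels-Unique s)
dels-Unique {w = yl j ∷ []}       _       = [] ∷ []
dels-Unique {w = yl j ∷ xl i ∷ w} (_ ∷ s) = map∷-Unique (yl j) (dels-Unique s)
dels-Unique {w = yl j ∷ yl k ∷ w} ((j<k ∷ _) ∷ s) =
  ∉-map∷ (λ { refl → Finₚ.<-irrefl refl j<k }) ∷ map∷-Unique (yl j) (dels-Unique s)

swaps-Unique : (w : Word m n) → Unique (swaps w)
swaps-Unique []                = []
swaps-Unique (xl i ∷ w)        = map∷-Unique (xl i) (swaps-Unique w)
swaps-Unique (yl j ∷ [])       = []
swaps-Unique (yl j ∷ xl i ∷ w) = ∉-map∷ (λ ()) ∷ map∷-Unique (yl j) (swaps-Unique (xl i ∷ w))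
swaps-Unique (yl j ∷ yl k ∷ w) = map∷-Unique (yl j) (swaps-Unique (yl k ∷ w))

inserts⁺ : {u v : Word m n} → Sorted v → Low ins u v → v ∈ inserts u
inserts⁺ {u = u} sv h with low-insX sv h
... | i , i∉ , refl = ∈-map⁺ (λ i → insX i u) (∈-filter⁺ (λ i → ¬? (xl i ∈? u)) (∈-allFin i) i∉)

inserts⁻ : (u : Word m n) {v : Word m n} → Sorted u → v ∈ inserts u → Sorted v × Low ins u v
inserts⁻ u su h with ∈-map⁻ (λ i → insX i u) h
... | i , h′ , refl = insX-Sorted (proj₂ (∈-filter⁻ (λ i → ¬? (xl i ∈? u)) {xs = allFin _} h′)) su , insX-low i u

inserts-Unique : (w : Word m n) → Unique (inserts w)
inserts-Unique w = Uniqueₚ.map⁺ (insX-injective w)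
  (Uniqueₚ.filter⁺ (λ i → ¬? (xl i ∈? w)) (Uniqueₚ.allFin⁺ _))

low-Sorted : ∀ {κ} {u v : Word m n} → κ ≢ ins → Sorted u → Low κ u v → Sorted v
low-Sorted κ su ins-end = ⊥-elim (κ refl)
low-Sorted κ su ins-x   = ⊥-elim (κ refl)
low-Sorted κ (_ ∷ s) del-end = s
low-Sorted κ (_ ∷ s) del-y   = s
low-Sorted κ su swap-yx = swap-mid-Sorted [] tt su
low-Sorted κ (l≺ ∷ su) (l ∷ h) = All.tabulate (below κ l≺ h) ∷ low-Sorted κ su h
  where
  below : ∀ {κ l u v} → κ ≢ ins → All (l ≺_) u → Low κ u v → ∀ {c : Letter _ _} → c ∈ v → l ≺ c
  below κ l≺ ins-end = ⊥-elim (κ refl)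
  below κ l≺ ins-x   = ⊥-elim (κ refl)
  below κ l≺ del-end = λ ()
  below κ l≺ del-y   = All.lookup l≺ ∘ there
  below κ l≺ swap-yx = All.lookup l≺ ∘ ∈-swap []
  below κ (p ∷ l≺) (l ∷ h) (here refl) = p
  below κ (p ∷ l≺) (l ∷ h) (there c∈)  = below κ l≺ h c∈

indelCovers covers : Word m n → List (Word m n)
indelCovers w = inserts w ++ dels w
covers w = indelCovers w ++ swaps w

indelCovers⁻ : (u : Word m n) {v : Word m n} → Sorted u → v ∈ indelCovers u →
  ∃ λ κ → κ ≢ swap × Sorted v × Low κ u v
indelCovers⁻ u su h with ∈-++⁻ (inserts u) h
... | inj₁ p = let sv , low = inserts⁻ u su p in ins , (λ ()) , sv , low
... | inj₂ p = del , (λ ()) , low-Sorted (λ ()) su (dels⁻ u p) , dels⁻ u p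

indelCovers-Unique : {w : Word m n} → Sorted w → Unique (indelCovers w)
indelCovers-Unique {w = w} s = Uniqueₚ.++⁺ (inserts-Unique w) (dels-Unique s) λ (p , q) →
  contradiction (low-kind (proj₂ (inserts⁻ w s p)) (dels⁻ w q)) λ ()

covers-Unique : {w : Word m n} → Sorted w → Unique (covers w)
covers-Unique {w = w} s = Uniqueₚ.++⁺ (indelCovers-Unique s) (swaps-Unique w) λ (p , q) →
  let κ , κ≢swap , _ , h = indelCovers⁻ w s p in κ≢swap (low-kind h (swaps⁻ w q))

indelCovers⁺ : ∀ {κ} {u v : Word m n} → κ ≢ swap → Sorted v → Low κ u v → v ∈ indelCovers u
indelCovers⁺ {κ = ins}  _  sv h = ∈-++⁺ˡ (inserts⁺ sv h)
indelCovers⁺ {κ = del} {u} _  sv h = ∈-++⁺ʳ (inserts u) (dels⁺ h)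
indelCovers⁺ {κ = swap} κ≢ sv h = ⊥-elim (κ≢ refl)

covers⁺ : ∀ {κ} {u v : Word m n} → Sorted v → Low κ u v → v ∈ covers u
covers⁺ {κ = ins}  sv h = ∈-++⁺ˡ (indelCovers⁺ (λ ()) sv h)
covers⁺ {κ = del}  sv h = ∈-++⁺ˡ (indelCovers⁺ (λ ()) sv h)
covers⁺ {κ = swap} {u} sv h = ∈-++⁺ʳ (indelCovers u) (swaps⁺ h)

covers-count : {u : Word m n} → Sorted u → HasCount (CoveredBy u) (length (covers u))
covers-count {u = u} su = covers u , covers-Unique su , refl , λ v → sound v , complete v
  where
  sound : ∀ v → v ∈ covers u → CoveredBy u v
  sound v h with ∈-++⁻ (indelCovers u) h
  ... | inj₁ p = let _ , _ , sv , low = indelCovers⁻ u su p in low⇒CoveredBy su sv low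
  ... | inj₂ p = low⇒CoveredBy su (low-Sorted (λ ()) su (swaps⁻ u p)) (swaps⁻ u p)
  complete : ∀ v → CoveredBy u v → v ∈ covers u
  complete v c = covers⁺ (isShuf⇒Sorted v (proj₁ c)) (proj₂ (CoveredBy⇒low c))

indelCovers-count : {u : Word m n} → Sorted u → HasCount (IndelCoveredBy u) (length (indelCovers u))
indelCovers-count {u = u} su = indelCovers u , indelCovers-Unique su , refl , λ v → sound v , complete v
  where
  sound : ∀ v → v ∈ indelCovers u → IndelCoveredBy u v
  sound v h with indelCovers⁻ u su h
  ... | κ , κ≢ , sv , low = low⇒CoveredBy su sv low , λ same →
    length≢ κ≢ (low-length low) (SameLetters⇒length su sv same)
    where
    length≢ : ∀ {κ a b} → κ ≢ swap → (κ ≡ ins × b ≡ suc a) ⊎ (κ ≡ del × a ≡ suc b) ⊎ (κ ≡ swap × b ≡ a) → a ≢ b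
    length≢ κ≢ (inj₁ (_ , refl)) e        = ℕₚ.1+n≢n (sym e)
    length≢ κ≢ (inj₂ (inj₁ (_ , refl))) e = ℕₚ.1+n≢n e
    length≢ κ≢ (inj₂ (inj₂ (e , _)))      = ⊥-elim (κ≢ e)
  complete : ∀ v → IndelCoveredBy u v → v ∈ indelCovers u
  complete v (c , differ) with CoveredBy⇒low c
  ... | ins  , low = indelCovers⁺ (λ ()) (isShuf⇒Sorted v (proj₁ c)) low
  ... | del  , low = indelCovers⁺ (λ ()) (isShuf⇒Sorted v (proj₁ c)) low
  ... | swap , low = ⊥-elim (differ (low-swap⇒SameLetters low))

HasCount-unique : ∀ {P : Word m n → Set} {k l} → HasCount P k → HasCount P l → k ≡ l
HasCount-unique (L , uL , refl , hL) (M , uM , refl , hM) = ↭-length (unique-set⇒↭ uL uM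
  (λ {z} p → proj₂ (hM z) (proj₁ (hL z) p)) (λ {z} p → proj₂ (hL z) (proj₁ (hM z) p)))

dels+swaps : (w : Word m n) → length (dels w) + length (swaps w) ≡ length (yIdx w)
dels+swaps [] = refl
dels+swaps (xl i ∷ w) = ≡-trans (cong₂ _+_ (Listₚ.length-map _ (dels w)) (Listₚ.length-map _ (swaps w))) (dels+swaps w)
dels+swaps (yl j ∷ []) = refl
dels+swaps (yl j ∷ xl i ∷ w) = ≡-trans
  (cong₂ (λ d s → d + suc s) (Listₚ.length-map _ (dels (xl i ∷ w))) (Listₚ.length-map _ (swaps (xl i ∷ w))))
  (≡-trans (ℕₚ.+-suc _ _) (cong suc (dels+swaps (xl i ∷ w))))
dels+swaps (yl j ∷ yl k ∷ w) = cong suc (≡-trans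
  (cong₂ _+_ (Listₚ.length-map _ (dels (yl k ∷ w))) (Listₚ.length-map _ (swaps (yl k ∷ w))))
  (dels+swaps (yl k ∷ w)))

presentX : Word m n → List (Fin m)
presentX []         = []
presentX (xl i ∷ w) = i ∷ presentX w
presentX (yl j ∷ w) = presentX w

∈-presentX⁺ : ∀ {i} {w : Word m n} → xl i ∈ w → i ∈ presentX w
∈-presentX⁺ {w = xl _ ∷ _} (here refl) = here refl
∈-presentX⁺ {w = xl _ ∷ _} (there h)   = there (∈-presentX⁺ h)
∈-presentX⁺ {w = yl _ ∷ _} (there h)   = ∈-presentX⁺ h

∈-presentX⁻ : ∀ {i} (w : Word m n) → i ∈ presentX w → xl i ∈ w
∈-presentX⁻ (xl _ ∷ w) (here refl) = here refl
∈-presentX⁻ (xl _ ∷ w) (there h)   = there (∈-presentX⁻ w h)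
∈-presentX⁻ (yl _ ∷ w) h           = there (∈-presentX⁻ w h)

presentX-Unique : {w : Word m n} → Unique w → Unique (presentX w)
presentX-Unique {w = []}       _ = []
presentX-Unique {w = xl i ∷ w} u@(_ ∷ u′) =
  All.tabulate (λ { h refl → Uniqueₚ.Unique[x∷xs]⇒x∉xs u (∈-presentX⁻ w h) }) ∷ presentX-Unique u′
presentX-Unique {w = yl j ∷ w} (_ ∷ u′) = presentX-Unique u′

presentX-length : (w : Word m n) → length (presentX w) ≡ length (xIdx w)
presentX-length []         = refl
presentX-length (xl i ∷ w) = cong suc (presentX-length w)
presentX-length (yl j ∷ w) = presentX-length w

present+absent : {w : Word m n} → Unique w → length (xIdx w) + length (absentX w) ≡ m
present+absent {m = m} {w = w} u = ≡-trans (cong (_+ length (absentX w)) (sym (presentX-length w)))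
  (≡-trans (sym (Listₚ.length-++ (presentX w)))
    (≡-trans (↭-length (unique-set⇒↭
      (Uniqueₚ.++⁺ (presentX-Unique u) (Uniqueₚ.filter⁺ (λ i → ¬? (xl i ∈? w)) (Uniqueₚ.allFin⁺ m))
        λ (p , q) → proj₂ (∈-filter⁻ (λ i → ¬? (xl i ∈? w)) {xs = allFin m} q) (∈-presentX⁻ w p))
      (Uniqueₚ.allFin⁺ m) (λ _ → ∈-allFin _) (λ {i} _ → member i)))
    (Listₚ.length-tabulate (λ i → i))))
  where
  member : ∀ i → i ∈ presentX w ++ absentX w
  member i with xl i ∈? w
  ... | yes p = ∈-++⁺ˡ (∈-presentX⁺ p)
  ... | no ¬p = ∈-++⁺ʳ (presentX w) (∈-filter⁺ (λ i → ¬? (xl i ∈? w)) (∈-allFin i) ¬p)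

length-indelCovers : (w : Word m n) → length (indelCovers w) ≡ length (absentX w) + length (dels w)
length-indelCovers w = ≡-trans (Listₚ.length-++ (inserts w))
  (cong (_+ length (dels w)) (Listₚ.length-map _ (absentX w)))

length-covers : (w : Word m n) → length (covers w) ≡ length (absentX w) + length (dels w) + length (swaps w)
length-covers w = ≡-trans (Listₚ.length-++ (indelCovers w)) (cong (_+ length (swaps w)) (length-indelCovers w))

-- The H-triangle

∑ : List A → (A → ℚ) → ℚ
∑ xs f = sumℚ (map f xs)

∑-++ : ∀ (xs : List A) {ys} f → ∑ (xs ++ ys) f ≡ ∑ xs f ℚ.+ ∑ ys f
∑-++ []       f = sym (ℚₚ.+-identityˡ _)
∑-++ (x ∷ xs) f = ≡-trans (cong (f x ℚ.+_) (∑-++ xs f)) (sym (ℚₚ.+-assoc (f x) _ _))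

∑-map : ∀ (g : A → B) xs {f} → ∑ (map g xs) f ≡ ∑ xs (f ∘ g)
∑-map g xs = cong sumℚ (sym (Listₚ.map-∘ xs))

∑-cong-∈ : ∀ (xs : List A) {f g} → (∀ {x} → x ∈ xs → f x ≡ g x) → ∑ xs f ≡ ∑ xs g
∑-cong-∈ []       h = refl
∑-cong-∈ (x ∷ xs) h = cong₂ ℚ._+_ (h (here refl)) (∑-cong-∈ xs (h ∘ there))

∑-cong : ∀ (xs : List A) {f g} → (∀ x → f x ≡ g x) → ∑ xs f ≡ ∑ xs g
∑-cong xs h = ∑-cong-∈ xs λ {x} _ → h x

∑-*ˡ : ∀ c (xs : List A) f → ∑ xs (λ x → c * f x) ≡ c * ∑ xs f
∑-*ˡ c []       f = sym (ℚₚ.*-zeroʳ c)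
∑-*ˡ c (x ∷ xs) f = ≡-trans (cong (c * f x ℚ.+_) (∑-*ˡ c xs f)) (sym (ℚₚ.*-distribˡ-+ c _ _))

∑-↭ : ∀ {xs ys : List A} f → xs ↭ ys → ∑ xs f ≡ ∑ ys f
∑-↭ f Perm.refl = refl
∑-↭ f (Perm.prep x p) = cong (f x ℚ.+_) (∑-↭ f p)
∑-↭ f (Perm.swap {ys = ys} x y p) = ≡-trans (sym (ℚₚ.+-assoc (f x) (f y) _))
  (≡-trans (cong₂ ℚ._+_ (ℚₚ.+-comm (f x) (f y)) (∑-↭ f p)) (ℚₚ.+-assoc (f y) (f x) (∑ ys f)))
∑-↭ f (Perm.trans p q) = ≡-trans (∑-↭ f p) (∑-↭ f q)

#x #y : Word m n → ℕ
#x w = length (xIdx w)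
#y w = length (yIdx w)

shuffles shufflesˣ shufflesʸ : List (Fin m) → List (Fin n) → List (Word m n)
shuffles xs ys = [] ∷ shufflesˣ xs ys ++ shufflesʸ xs ys
shufflesˣ []       ys = []
shufflesˣ (x ∷ xs) ys = map (xl x ∷_) (shuffles xs ys) ++ shufflesˣ xs ys
shufflesʸ xs []       = []
shufflesʸ xs (y ∷ ys) = map (yl y ∷_) (shuffles xs ys) ++ shufflesʸ xs ys

module _ {m n : ℕ} where

  Over : List (Fin m) → List (Fin n) → Word m n → Set
  Over xs ys w = (∀ {i} → xl i ∈ w → i ∈ xs) × (∀ {j} → yl j ∈ w → j ∈ ys)

  shuffles⁺ : ∀ {xs ys} w → AllPairs Fin._<_ xs → AllPairs Fin._<_ ys → Sorted w → Over xs ys w →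
    w ∈ shuffles xs ys
  shufflesˣ⁺ : ∀ {xs ys} i w → AllPairs Fin._<_ xs → AllPairs Fin._<_ ys → Sorted (xl i ∷ w) →
    i ∈ xs → Over xs ys (xl i ∷ w) → xl i ∷ w ∈ shufflesˣ xs ys
  shufflesʸ⁺ : ∀ {xs ys} j w → AllPairs Fin._<_ xs → AllPairs Fin._<_ ys → Sorted (yl j ∷ w) →
    j ∈ ys → Over xs ys (yl j ∷ w) → yl j ∷ w ∈ shufflesʸ xs ys

  shuffles⁺ []         sx sy sw o = here refl
  shuffles⁺ (xl i ∷ w) sx sy sw o@(ox , _) = there (∈-++⁺ˡ (shufflesˣ⁺ i w sx sy sw (ox (here refl)) o))
  shuffles⁺ {xs = xs} {ys} (yl j ∷ w) sx sy sw o@(_ , oy) =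
    there (∈-++⁺ʳ (shufflesˣ xs ys) (shufflesʸ⁺ j w sx sy sw (oy (here refl)) o))

  shufflesˣ⁺ i w (x≺ ∷ sx) sy (i≺ ∷ sw) (here refl) (ox , oy) =
    ∈-++⁺ˡ (∈-map⁺ (xl i ∷_) (shuffles⁺ w sx sy sw (ox′ , oy ∘ there)))
    where
    ox′ : ∀ {k} → xl k ∈ w → k ∈ _
    ox′ h with ox (there h)
    ... | here refl = ⊥-elim (ℕₚ.<-irrefl refl (All.lookup i≺ h))
    ... | there p   = p
  shufflesˣ⁺ {xs = x ∷ xs} {ys} i w (x≺ ∷ sx) sy sw@(i≺ ∷ _) (there i∈) (ox , oy) =
    ∈-++⁺ʳ (map (xl x ∷_) (shuffles xs ys)) (shufflesˣ⁺ i w sx sy sw i∈ (ox′ , oy))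
    where
    ox′ : ∀ {k} → xl k ∈ xl i ∷ w → k ∈ xs
    ox′ (here refl) = i∈
    ox′ (there h) with ox (there h)
    ... | here refl = ⊥-elim (ℕₚ.<-asym (All.lookup x≺ i∈) (All.lookup i≺ h))
    ... | there p   = p

  shufflesʸ⁺ j w sx (y≺ ∷ sy) (j≺ ∷ sw) (here refl) (ox , oy) =
    ∈-++⁺ˡ (∈-map⁺ (yl j ∷_) (shuffles⁺ w sx sy sw (ox ∘ there , oy′)))
    where
    oy′ : ∀ {k} → yl k ∈ w → k ∈ _
    oy′ h with oy (there h)
    ... | here refl = ⊥-elim (ℕₚ.<-irrefl refl (All.lookup j≺ h))
    ... | there p   = p
  shufflesʸ⁺ {xs = xs} {y ∷ ys} j w sx (y≺ ∷ sy) sw@(j≺ ∷ _) (there j∈) (ox , oy) =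
    ∈-++⁺ʳ (map (yl y ∷_) (shuffles xs ys)) (shufflesʸ⁺ j w sx sy sw j∈ (ox , oy′))
    where
    oy′ : ∀ {k} → yl k ∈ yl j ∷ w → k ∈ ys
    oy′ (here refl) = j∈
    oy′ (there h) with oy (there h)
    ... | here refl = ⊥-elim (ℕₚ.<-asym (All.lookup y≺ j∈) (All.lookup j≺ h))
    ... | there p   = p

  Over-∷ : ∀ {xs xs′ ys ys′ l w} → (∀ {i} → i ∈ xs → i ∈ xs′) → (∀ {j} → j ∈ ys → j ∈ ys′) →
    Over xs′ ys′ (l ∷ []) → Over xs ys w → Over xs′ ys′ (l ∷ w)
  Over-∷ f g (hx , hy) (ox , oy) =
    (λ { (here refl) → hx (here refl) ; (there h) → f (ox h) }) ,
    (λ { (here refl) → hy (here refl) ; (there h) → g (oy h) })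

  shuffles⁻  : ∀ xs ys {w} → AllPairs Fin._<_ xs → AllPairs Fin._<_ ys → w ∈ shuffles xs ys →
    Sorted w × Over xs ys w
  shufflesˣ⁻ : ∀ xs ys {w} → AllPairs Fin._<_ xs → AllPairs Fin._<_ ys → w ∈ shufflesˣ xs ys →
    Sorted w × Over xs ys w
  shufflesʸ⁻ : ∀ xs ys {w} → AllPairs Fin._<_ xs → AllPairs Fin._<_ ys → w ∈ shufflesʸ xs ys →
    Sorted w × Over xs ys w

  shuffles⁻ xs ys sx sy (here refl) = [] , (λ ()) , (λ ())
  shuffles⁻ xs ys sx sy (there h) with ∈-++⁻ (shufflesˣ xs ys) h
  ... | inj₁ p = shufflesˣ⁻ xs ys sx sy p
  ... | inj₂ p = shufflesʸ⁻ xs ys sx sy p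

  shufflesˣ⁻ (x ∷ xs) ys (x≺ ∷ sx) sy h with ∈-++⁻ (map (xl x ∷_) (shuffles xs ys)) h
  ... | inj₂ p = let sw , ox , oy = shufflesˣ⁻ xs ys sx sy p in sw , (there ∘ ox) , oy
  ... | inj₁ p with ∈-map⁻ (xl x ∷_) p
  ... | w , q , refl = let sw , o = shuffles⁻ xs ys sx sy q in
    All.tabulate (λ {c} → x≺w (proj₁ o) c) ∷ sw ,
    Over-∷ there (λ z → z) ((λ { (here refl) → here refl ; (there ()) }) , λ { (here ()) ; (there ()) }) o
    where
    x≺w : ∀ {w : Word m n} → (∀ {i} → xl i ∈ w → i ∈ xs) → ∀ c → c ∈ w → xl x ≺ c
    x≺w ox (xl i) h = All.lookup x≺ (ox h)
    x≺w ox (yl j) h = tt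

  shufflesʸ⁻ xs (y ∷ ys) sx (y≺ ∷ sy) h with ∈-++⁻ (map (yl y ∷_) (shuffles xs ys)) h
  ... | inj₂ p = let sw , ox , oy = shufflesʸ⁻ xs ys sx sy p in sw , ox , (there ∘ oy)
  ... | inj₁ p with ∈-map⁻ (yl y ∷_) p
  ... | w , q , refl = let sw , o = shuffles⁻ xs ys sx sy q in
    All.tabulate (λ {c} → y≺w (proj₂ o) c) ∷ sw ,
    Over-∷ (λ z → z) there ((λ { (here ()) ; (there ()) }) , λ { (here refl) → here refl ; (there ()) }) o
    where
    y≺w : ∀ {w : Word m n} → (∀ {j} → yl j ∈ w → j ∈ ys) → ∀ c → c ∈ w → yl y ≺ c
    y≺w oy (xl i) h = tt
    y≺w oy (yl j) h = All.lookup y≺ (oy h)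

  headX : ∀ xs ys {w} → w ∈ shufflesˣ xs ys → Σ _ λ i → Σ (Word m n) λ v → w ≡ xl i ∷ v × i ∈ xs
  headX (x ∷ xs) ys h with ∈-++⁻ (map (xl x ∷_) (shuffles xs ys)) h
  ... | inj₁ p = let v , _ , e = ∈-map⁻ (xl x ∷_) p in x , v , e , here refl
  ... | inj₂ p = let i , v , e , i∈ = headX xs ys p in i , v , e , there i∈

  headY : ∀ xs ys {w} → w ∈ shufflesʸ xs ys → Σ _ λ j → Σ (Word m n) λ v → w ≡ yl j ∷ v × j ∈ ys
  headY xs (y ∷ ys) h with ∈-++⁻ (map (yl y ∷_) (shuffles xs ys)) h
  ... | inj₁ p = let v , _ , e = ∈-map⁻ (yl y ∷_) p in y , v , e , here refl
  ... | inj₂ p = let i , v , e , i∈ = headY xs ys p in i , v , e , there i∈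

  shuffles-Unique : ∀ xs ys → Unique xs → Unique ys → Unique (shuffles xs ys)
  shufflesˣ-Unique : ∀ xs ys → Unique xs → Unique ys → Unique (shufflesˣ xs ys)
  shufflesʸ-Unique : ∀ xs ys → Unique xs → Unique ys → Unique (shufflesʸ xs ys)

  shuffles-Unique xs ys ux uy = All.tabulate nonempty ∷
    Uniqueₚ.++⁺ (shufflesˣ-Unique xs ys ux uy) (shufflesʸ-Unique xs ys ux uy) disjoint
    where
    disjoint : ∀ {w} → w ∈ shufflesˣ xs ys × w ∈ shufflesʸ xs ys → ⊥
    disjoint (p , q) with headX xs ys p | headY xs ys q
    ... | _ , _ , refl , _ | _ , _ , () , _
    nonempty : ∀ {w} → w ∈ shufflesˣ xs ys ++ shufflesʸ xs ys → [] ≢ w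
    nonempty h refl with ∈-++⁻ (shufflesˣ xs ys) h
    ... | inj₁ p with _ , _ , () , _ ← headX xs ys p
    ... | inj₂ p with _ , _ , () , _ ← headY xs ys p
  shufflesˣ-Unique []       ys ux uy = []
  shufflesˣ-Unique (x ∷ xs) ys u@(_ ∷ ux) uy =
    Uniqueₚ.++⁺ (map∷-Unique (xl x) (shuffles-Unique xs ys ux uy)) (shufflesˣ-Unique xs ys ux uy) disjoint
    where
    disjoint : ∀ {w} → w ∈ map (xl x ∷_) (shuffles xs ys) × w ∈ shufflesˣ xs ys → ⊥
    disjoint (p , q) with ∈-map⁻ (xl x ∷_) p | headX xs ys q
    ... | _ , _ , refl | _ , _ , refl , x∈ = Uniqueₚ.Unique[x∷xs]⇒x∉xs u x∈
  shufflesʸ-Unique xs []       ux uy = []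
  shufflesʸ-Unique xs (y ∷ ys) ux u@(_ ∷ uy) =
    Uniqueₚ.++⁺ (map∷-Unique (yl y) (shuffles-Unique xs ys ux uy)) (shufflesʸ-Unique xs ys ux uy) disjoint
    where
    disjoint : ∀ {w} → w ∈ map (yl y ∷_) (shuffles xs ys) × w ∈ shufflesʸ xs ys → ⊥
    disjoint (p , q) with ∈-map⁻ (yl y ∷_) p | headY xs ys q
    ... | _ , _ , refl | _ , _ , refl , y∈ = Uniqueₚ.Unique[x∷xs]⇒x∉xs u y∈

  #x≤ : ∀ xs ys {w : Word m n} → w ∈ shuffles xs ys → #x w ℕ.≤ length xs
  #x≤ˣ : ∀ xs ys {w : Word m n} → w ∈ shufflesˣ xs ys → #x w ℕ.≤ length xs
  #x≤ʸ : ∀ xs ys {w : Word m n} → w ∈ shufflesʸ xs ys → #x w ℕ.≤ length xs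
  #x≤ xs ys (here refl) = ℕ.z≤n
  #x≤ xs ys (there h) = [ #x≤ˣ xs ys , #x≤ʸ xs ys ]′ (∈-++⁻ (shufflesˣ xs ys) h)
  #x≤ˣ (x ∷ xs) ys h with ∈-++⁻ (map (xl x ∷_) (shuffles xs ys)) h
  ... | inj₂ p = ℕₚ.m≤n⇒m≤1+n (#x≤ˣ xs ys p)
  ... | inj₁ p with _ , q , refl ← ∈-map⁻ (xl x ∷_) p = ℕ.s≤s (#x≤ xs ys q)
  #x≤ʸ xs (y ∷ ys) h with ∈-++⁻ (map (yl y ∷_) (shuffles xs ys)) h
  ... | inj₂ p = #x≤ʸ xs ys p
  ... | inj₁ p with _ , q , refl ← ∈-map⁻ (yl y ∷_) p = #x≤ xs ys q

  #y≤ : ∀ xs ys {w : Word m n} → w ∈ shuffles xs ys → #y w ℕ.≤ length ys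
  #y≤ˣ : ∀ xs ys {w : Word m n} → w ∈ shufflesˣ xs ys → #y w ℕ.≤ length ys
  #y≤ʸ : ∀ xs ys {w : Word m n} → w ∈ shufflesʸ xs ys → #y w ℕ.≤ length ys
  #y≤ xs ys (here refl) = ℕ.z≤n
  #y≤ xs ys (there h) = [ #y≤ˣ xs ys , #y≤ʸ xs ys ]′ (∈-++⁻ (shufflesˣ xs ys) h)
  #y≤ˣ (x ∷ xs) ys h with ∈-++⁻ (map (xl x ∷_) (shuffles xs ys)) h
  ... | inj₂ p = #y≤ˣ xs ys p
  ... | inj₁ p with _ , q , refl ← ∈-map⁻ (xl x ∷_) p = #y≤ xs ys q
  #y≤ʸ xs (y ∷ ys) h with ∈-++⁻ (map (yl y ∷_) (shuffles xs ys)) h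
  ... | inj₂ p = ℕₚ.m≤n⇒m≤1+n (#y≤ʸ xs ys p)
  ... | inj₁ p with _ , q , refl ← ∈-map⁻ (yl y ∷_) p = ℕ.s≤s (#y≤ xs ys q)

allFin-sorted : ∀ k → AllPairs Fin._<_ (allFin k)
allFin-sorted k = AllPairsₚ.tabulate⁺-< λ i<j → i<j

Sorted⇒∈shuffles : {w : Word m n} → Sorted w → w ∈ shuffles (allFin m) (allFin n)
Sorted⇒∈shuffles {w = w} s =
  shuffles⁺ w (allFin-sorted _) (allFin-sorted _) s ((λ _ → ∈-allFin _) , (λ _ → ∈-allFin _))

length≡#x+#y : (w : Word m n) → length w ≡ #x w + #y w
length≡#x+#y []         = refl
length≡#x+#y (xl i ∷ w) = cong suc (length≡#x+#y w)
length≡#x+#y (yl j ∷ w) = ≡-trans (cong suc (length≡#x+#y w)) (sym (ℕₚ.+-suc _ _))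

length-allFin : ∀ k → length (allFin k) ≡ k
length-allFin k = Listₚ.length-tabulate (λ i → i)

Sorted⇒length≤ : {w : Word m n} → Sorted w → length w ℕ.≤ m + n
Sorted⇒length≤ {m} {n} {w} s = subst (ℕ._≤ m + n) (sym (length≡#x+#y w)) (ℕₚ.+-mono-≤ {#x w} {m} {#y w} {n}
  (subst (#x w ℕ.≤_) (length-allFin m) (#x≤ (allFin m) (allFin n) w∈))
  (subst (#y w ℕ.≤_) (length-allFin n) (#y≤ (allFin m) (allFin n) w∈)))
  where w∈ = Sorted⇒∈shuffles s

concatMap-Unique : (f : A → List B) {xs : List A} → Unique xs → (∀ x → Unique (f x)) →
  (∀ {x y z} → z ∈ f x → z ∈ f y → x ≡ y) → Unique (concatMap f xs)
concatMap-Unique f {[]}     _          uf sep = []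
concatMap-Unique f {x ∷ xs} u@(_ ∷ us) uf sep =
  Uniqueₚ.++⁺ (uf x) (concatMap-Unique f us uf sep) λ (p , q) →
    let y , y∈ , q′ = ∈-concatMap⁻′ xs q in
    Uniqueₚ.Unique[x∷xs]⇒x∉xs u (subst (_∈ xs) (sep q′ p) y∈)
  where
  ∈-concatMap⁻′ : ∀ xs {z} → z ∈ concatMap f xs → ∃ λ y → y ∈ xs × z ∈ f y
  ∈-concatMap⁻′ (y ∷ xs) h with ∈-++⁻ (f y) h
  ... | inj₁ p = y , here refl , p
  ... | inj₂ p = let y′ , a , b = ∈-concatMap⁻′ xs p in y′ , there a , b

letters-Unique : Unique (letters m n)
letters-Unique {m} {n} = Uniqueₚ.++⁺ (Uniqueₚ.map⁺ xl-injective (Uniqueₚ.allFin⁺ m))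
  (Uniqueₚ.map⁺ (λ { refl → refl }) (Uniqueₚ.allFin⁺ n)) disjoint
  where
  disjoint : ∀ {z} → z ∈ map xl (allFin m) × z ∈ map yl (allFin n) → ⊥
  disjoint (p , q) with ∈-map⁻ xl p | ∈-map⁻ yl q
  ... | _ , _ , refl | _ , _ , ()

∈-letters : (a : Letter m n) → a ∈ letters m n
∈-letters (xl i)     = ∈-++⁺ˡ (∈-map⁺ xl (∈-allFin i))
∈-letters {m} (yl j) = ∈-++⁺ʳ (map xl (allFin m)) (∈-map⁺ yl (∈-allFin j))

∈-concatMap : ∀ (f : A → List B) {xs x z} → x ∈ xs → z ∈ f x → z ∈ concatMap f xs
∈-concatMap f {x ∷ xs} (here refl) z∈ = ∈-++⁺ˡ z∈
∈-concatMap f {x ∷ xs} (there x∈)  z∈ = ∈-++⁺ʳ (f x) (∈-concatMap f x∈ z∈)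

wordsOfLen-Unique : ∀ k → Unique (wordsOfLen m n k)
wordsOfLen-Unique zero    = [] ∷ []
wordsOfLen-Unique {m} {n} (suc k) = concatMap-Unique (λ a → map (a ∷_) (wordsOfLen m n k)) letters-Unique
  (λ a → map∷-Unique a (wordsOfLen-Unique k)) sep
  where
  sep : ∀ {a b z} → z ∈ map (a ∷_) (wordsOfLen m n k) → z ∈ map (b ∷_) (wordsOfLen m n k) → a ≡ b
  sep {a} {b} p q with ∈-map⁻ (a ∷_) p | ∈-map⁻ (b ∷_) q
  ... | _ , _ , refl | _ , _ , refl = refl

∈-wordsOfLen : (w : Word m n) → w ∈ wordsOfLen m n (length w)
∈-wordsOfLen []      = here refl
∈-wordsOfLen (a ∷ w) = ∈-concatMap (λ a → map (a ∷_) (wordsOfLen _ _ (length w))) (∈-letters a)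
  (∈-map⁺ (a ∷_) (∈-wordsOfLen w))

wordsOfLen-length : ∀ k {w : Word m n} → w ∈ wordsOfLen m n k → length w ≡ k
wordsOfLen-length zero    (here refl) = refl
wordsOfLen-length {m} {n} (suc k) h = go (letters m n) h
  where
  go : ∀ as {w} → w ∈ concatMap (λ a → map (a ∷_) (wordsOfLen m n k)) as → length w ≡ suc k
  go (a ∷ as) h with ∈-++⁻ (map (a ∷_) (wordsOfLen m n k)) h
  ... | inj₂ q = go as q
  ... | inj₁ p with _ , r , refl ← ∈-map⁻ (a ∷_) p = cong suc (wordsOfLen-length k r)

Shuf↭shuffles : ∀ m n → Shuf m n ↭ shuffles (allFin m) (allFin n)
Shuf↭shuffles m n = unique-set⇒↭
  (Uniqueₚ.filter⁺ (T? ∘ isShuf) (concatMap-Unique (wordsOfLen m n) (Uniqueₚ.upTo⁺ (suc (m + n))) wordsOfLen-Unique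
    λ p q → ≡-trans (sym (wordsOfLen-length _ p)) (wordsOfLen-length _ q)))
  (shuffles-Unique _ _ (Uniqueₚ.allFin⁺ m) (Uniqueₚ.allFin⁺ n))
  (λ {w} h → Sorted⇒∈shuffles (isShuf⇒Sorted w (proj₂ (∈-filter⁻ (T? ∘ isShuf) {xs = wordsUpTo m n (m + n)} h))))
  (λ {w} h → let s = proj₁ (shuffles⁻ (allFin m) (allFin n) (allFin-sorted m) (allFin-sorted n) h) in
    ∈-filter⁺ (T? ∘ isShuf)
      (∈-concatMap (wordsOfLen m n) (∈-upTo⁺ {n = suc (m + n)} (ℕ.s≤s (Sorted⇒length≤ s))) (∈-wordsOfLen w)) (Sorted⇒isShuf s))

pow-+ : ∀ p k l → pow p (k + l) ≡ pow p k * pow p l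
pow-+ p zero    l = sym (ℚₚ.*-identityˡ _)
pow-+ p (suc k) l = ≡-trans (cong (p *_) (pow-+ p k l)) (sym (ℚₚ.*-assoc p _ _))

pow-* : ∀ p r k → pow (p * r) k ≡ pow p k * pow r k
pow-* p r zero    = refl
pow-* p r (suc k) = ≡-trans (cong (p * r *_) (pow-* p r k))
  (solve 4 (λ p r a b → p :* r :* (a :* b) := p :* a :* (r :* b)) refl p r (pow p k) (pow r k))
  where open +-*-Solver

suc∸ : ∀ {k a} → k ℕ.≤ a → suc a ℕ.∸ k ≡ suc (a ℕ.∸ k)
suc∸ = ℕₚ.+-∸-assoc 1

module Triangles (q t : ℚ) where

  T₁ s : ℚ
  T₁ = t ℚ.+ 1ℚ
  s = q ℚ.+ T₁

  G : ℕ → ℕ → ℚ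
  G zero    n       = pow s n
  G (suc m) zero    = pow s (suc m)
  G (suc m) (suc n) = s * (G m (suc n) ℚ.+ G (suc m) n) ℚ.+ (q * (q ℚ.+ 1ℚ) - s * s) * G m n

  G-zeroʳ : ∀ k → G k zero ≡ pow s k
  G-zeroʳ zero    = refl
  G-zeroʳ (suc k) = refl

  weight : ℕ → ℕ → Word m n → ℚ
  weight a b w = pow q (#x w) * pow T₁ (a ℕ.∸ #x w) *
    (pow q (b ℕ.∸ #y w) * pow T₁ (length (dels w)) * pow (q ℚ.+ 1ℚ) (length (swaps w)))

  open +-*-Solver

  weight-x : ∀ a b i (w : Word m n) → weight (suc a) b (xl i ∷ w) ≡ q * weight a b w
  weight-x a b i w = ≡-trans
    (cong₂ (λ k l → q * pow q (#x w) * pow T₁ (a ℕ.∸ #x w) *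
        (pow q (b ℕ.∸ #y w) * pow T₁ k * pow (q ℚ.+ 1ℚ) l))
      (Listₚ.length-map _ (dels w)) (Listₚ.length-map _ (swaps w)))
    (solve 4 (λ q α β γ → q :* α :* β :* γ := q :* (α :* β :* γ)) refl q (pow q (#x w)) (pow T₁ (a ℕ.∸ #x w)) _)

  weight-skip-x : ∀ a b (w : Word m n) → #x w ℕ.≤ a → weight (suc a) b w ≡ T₁ * weight a b w
  weight-skip-x a b w h = ≡-trans
    (cong (λ k → pow q (#x w) * pow T₁ k * rest) (suc∸ h))
    (solve 4 (λ τ α β γ → α :* (τ :* β) :* γ := τ :* (α :* β :* γ)) refl T₁ (pow q (#x w)) (pow T₁ (a ℕ.∸ #x w)) rest)
    where rest = pow q (b ℕ.∸ #y w) * pow T₁ (length (dels w)) * pow (q ℚ.+ 1ℚ) (length (swaps w))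

  weight-skip-y : ∀ a b (w : Word m n) → #y w ℕ.≤ b → weight a (suc b) w ≡ q * weight a b w
  weight-skip-y a b w h = ≡-trans
    (cong (λ k → c * (pow q k * d * e)) (suc∸ h))
    (solve 5 (λ q c p d e → c :* (q :* p :* d :* e) := q :* (c :* (p :* d :* e))) refl q c (pow q (b ℕ.∸ #y w)) d e)
    where
    c = pow q (#x w) * pow T₁ (a ℕ.∸ #x w)
    d = pow T₁ (length (dels w))
    e = pow (q ℚ.+ 1ℚ) (length (swaps w))

  weight-del : ∀ a b j (w : Word m n) → length (dels (yl j ∷ w)) ≡ suc (length (dels w)) →
    length (swaps (yl j ∷ w)) ≡ length (swaps w) → weight a (suc b) (yl j ∷ w) ≡ T₁ * weight a b w
  weight-del a b j w hd hs = ≡-trans (cong₂ (λ k l → c * (p * pow T₁ k * pow (q ℚ.+ 1ℚ) l)) hd hs)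
    (solve 5 (λ τ c p d e → c :* (p :* (τ :* d) :* e) := τ :* (c :* (p :* d :* e))) refl T₁ c p
      (pow T₁ (length (dels w))) (pow (q ℚ.+ 1ℚ) (length (swaps w))))
    where
    c = pow q (#x w) * pow T₁ (a ℕ.∸ #x w)
    p = pow q (b ℕ.∸ #y w)

  weight-swap : ∀ a b j i (w : Word m n) →
    weight a (suc b) (yl j ∷ xl i ∷ w) ≡ (q ℚ.+ 1ℚ) * weight a b (xl i ∷ w)
  weight-swap {m} {n} a b j i w = ≡-trans
    (cong₂ (λ k l → c * (p * pow T₁ k * ((q ℚ.+ 1ℚ) * pow (q ℚ.+ 1ℚ) l)))
      (Listₚ.length-map _ (dels v)) (Listₚ.length-map _ (swaps v)))
    (solve 5 (λ τ c p d e → c :* (p :* d :* (τ :* e)) := τ :* (c :* (p :* d :* e))) refl (q ℚ.+ 1ℚ) c p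
      (pow T₁ (length (dels v))) (pow (q ℚ.+ 1ℚ) (length (swaps v))))
    where
    v : Word m n
    v = xl i ∷ w
    c = pow q (#x v) * pow T₁ (a ℕ.∸ #x v)
    p = pow q (b ℕ.∸ #y v)

  H-rec-identity : ∀ q t o a b a₁ b₁ →
    let T = t ℚ.+ 1ℚ ; s = q ℚ.+ T ; h = o ℚ.+ (a ℚ.+ b)
        a₁₀ = q * h ℚ.+ T * a
        b₀₁ = (T * o ℚ.+ ((q ℚ.+ 1ℚ) * a ℚ.+ T * b)) ℚ.+ q * b
        h₁₀ = T * o ℚ.+ (a₁₀ ℚ.+ b₁)
        h₀₁ = q * o ℚ.+ (a₁ ℚ.+ b₀₁) in
    T * (q * o) ℚ.+ ((q * h₀₁ ℚ.+ T * a₁) ℚ.+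
      ((T * (T * o) ℚ.+ ((q ℚ.+ 1ℚ) * a₁₀ ℚ.+ T * b₁)) ℚ.+ q * b₁))
    ≡ s * (h₀₁ ℚ.+ h₁₀) ℚ.+ (q * (q ℚ.+ 1ℚ) - s * s) * h
  H-rec-identity = solve 7 (λ q t o a b a₁ b₁ →
    let T = t :+ con 1ℚ ; s = q :+ T ; h = o :+ (a :+ b)
        a₁₀ = q :* h :+ T :* a
        b₀₁ = (T :* o :+ ((q :+ con 1ℚ) :* a :+ T :* b)) :+ q :* b
        h₁₀ = T :* o :+ (a₁₀ :+ b₁)
        h₀₁ = q :* o :+ (a₁ :+ b₀₁) in
    T :* (q :* o) :+ ((q :* h₀₁ :+ T :* a₁) :+
      ((T :* (T :* o) :+ ((q :+ con 1ℚ) :* a₁₀ :+ T :* b₁)) :+ q :* b₁))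
    := s :* (h₀₁ :+ h₁₀) :+ (q :* (q :+ con 1ℚ) :- s :* s) :* h) refl

  module _ {m n : ℕ} where

    wt : List (Fin m) → List (Fin n) → Word m n → ℚ
    wt xs ys = weight (length xs) (length ys)

    H Hˣ Hʸ O : List (Fin m) → List (Fin n) → ℚ
    H  xs ys = ∑ (shuffles xs ys) (wt xs ys)
    Hˣ xs ys = ∑ (shufflesˣ xs ys) (wt xs ys)
    Hʸ xs ys = ∑ (shufflesʸ xs ys) (wt xs ys)
    O  xs ys = wt xs ys []

    H-split : ∀ xs ys → H xs ys ≡ O xs ys ℚ.+ (Hˣ xs ys ℚ.+ Hʸ xs ys)
    H-split xs ys = cong (O xs ys ℚ.+_) (∑-++ (shufflesˣ xs ys) (wt xs ys))

    O-x : ∀ x xs ys → O (x ∷ xs) ys ≡ T₁ * O xs ys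
    O-x x xs ys = weight-skip-x {m} {n} (length xs) (length ys) [] ℕ.z≤n

    O-y : ∀ xs y ys → O xs (y ∷ ys) ≡ q * O xs ys
    O-y xs y ys = weight-skip-y {m} {n} (length xs) (length ys) [] ℕ.z≤n

    Hˣ-x : ∀ x xs ys → Hˣ (x ∷ xs) ys ≡ q * H xs ys ℚ.+ T₁ * Hˣ xs ys
    Hˣ-x x xs ys = ≡-trans (∑-++ (map (xl x ∷_) (shuffles xs ys)) {shufflesˣ xs ys} (wt (x ∷ xs) ys)) (cong₂ ℚ._+_
      (≡-trans (∑-map (xl x ∷_) (shuffles xs ys) {wt (x ∷ xs) ys})
        (≡-trans (∑-cong (shuffles xs ys) (weight-x (length xs) (length ys) x))
          (∑-*ˡ q (shuffles xs ys) (wt xs ys))))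
      (≡-trans (∑-cong-∈ (shufflesˣ xs ys) {wt (x ∷ xs) ys} λ {w} h → weight-skip-x (length xs) (length ys) w (#x≤ˣ xs ys h))
        (∑-*ˡ T₁ (shufflesˣ xs ys) (wt xs ys))))

    wt-y-x : ∀ y xs ys → ∑ (shufflesˣ xs ys) (wt xs (y ∷ ys) ∘ (yl y ∷_)) ≡ (q ℚ.+ 1ℚ) * Hˣ xs ys
    wt-y-x y xs ys = ≡-trans (∑-cong-∈ (shufflesˣ xs ys) {wt xs (y ∷ ys) ∘ (yl y ∷_)} step) (∑-*ˡ (q ℚ.+ 1ℚ) (shufflesˣ xs ys) (wt xs ys))
      where
      step : ∀ {w} → w ∈ shufflesˣ xs ys → wt xs (y ∷ ys) (yl y ∷ w) ≡ (q ℚ.+ 1ℚ) * wt xs ys w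
      step h with headX xs ys h
      ... | i , w , refl , _ = weight-swap (length xs) (length ys) y i w

    wt-y-y : ∀ y xs ys → ∑ (shufflesʸ xs ys) (wt xs (y ∷ ys) ∘ (yl y ∷_)) ≡ T₁ * Hʸ xs ys
    wt-y-y y xs ys = ≡-trans (∑-cong-∈ (shufflesʸ xs ys) {wt xs (y ∷ ys) ∘ (yl y ∷_)} step) (∑-*ˡ T₁ (shufflesʸ xs ys) (wt xs ys))
      where
      step : ∀ {w} → w ∈ shufflesʸ xs ys → wt xs (y ∷ ys) (yl y ∷ w) ≡ T₁ * wt xs ys w
      step h with headY xs ys h
      ... | j , w , refl , _ = weight-del (length xs) (length ys) y (yl j ∷ w)
        (cong suc (Listₚ.length-map _ (dels (yl j ∷ w)))) (Listₚ.length-map _ (swaps (yl j ∷ w)))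

    Hʸ-y : ∀ xs y ys → Hʸ xs (y ∷ ys) ≡
      (T₁ * O xs ys ℚ.+ ((q ℚ.+ 1ℚ) * Hˣ xs ys ℚ.+ T₁ * Hʸ xs ys)) ℚ.+ q * Hʸ xs ys
    Hʸ-y xs y ys = ≡-trans (∑-++ (map (yl y ∷_) (shuffles xs ys)) {shufflesʸ xs ys} (wt xs (y ∷ ys))) (cong₂ ℚ._+_
      (≡-trans (∑-map (yl y ∷_) (shuffles xs ys) {wt xs (y ∷ ys)}) (cong₂ ℚ._+_ (weight-del {m} {n} (length xs) (length ys) y [] refl refl)
        (≡-trans (∑-++ (shufflesˣ xs ys) {shufflesʸ xs ys} (wt xs (y ∷ ys) ∘ (yl y ∷_))) (cong₂ ℚ._+_ (wt-y-x y xs ys) (wt-y-y y xs ys)))))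
      (≡-trans (∑-cong-∈ (shufflesʸ xs ys) {wt xs (y ∷ ys)} λ {w} h → weight-skip-y (length xs) (length ys) w (#y≤ʸ xs ys h))
        (∑-*ˡ q (shufflesʸ xs ys) (wt xs ys))))

    H-rec : ∀ x xs y ys → H (x ∷ xs) (y ∷ ys) ≡
      s * (H xs (y ∷ ys) ℚ.+ H (x ∷ xs) ys) ℚ.+ (q * (q ℚ.+ 1ℚ) - s * s) * H xs ys
    H-rec x xs y ys = combine (O xs ys) (Hˣ xs ys) (Hʸ xs ys) (Hˣ xs (y ∷ ys)) (Hʸ (x ∷ xs) ys)
      (H-split xs ys) (O-x x xs ys) (O-y xs y ys) (≡-trans (O-x x xs (y ∷ ys)) (cong (T₁ *_) (O-y xs y ys)))
      (Hˣ-x x xs ys) (Hʸ-y xs y ys) (H-split (x ∷ xs) ys) (H-split xs (y ∷ ys))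
      (Hˣ-x x xs (y ∷ ys)) (Hʸ-y (x ∷ xs) y ys) (H-split (x ∷ xs) (y ∷ ys))
      where
      combine : ∀ o a b a₁ b₁ {h o₁₀ o₀₁ o₁₁ a₁₀ b₀₁ h₁₀ h₀₁ a₁₁ b₁₁ h₁₁} →
        h ≡ o ℚ.+ (a ℚ.+ b) → o₁₀ ≡ T₁ * o → o₀₁ ≡ q * o → o₁₁ ≡ T₁ * (q * o) →
        a₁₀ ≡ q * h ℚ.+ T₁ * a →
        b₀₁ ≡ (T₁ * o ℚ.+ ((q ℚ.+ 1ℚ) * a ℚ.+ T₁ * b)) ℚ.+ q * b →
        h₁₀ ≡ o₁₀ ℚ.+ (a₁₀ ℚ.+ b₁) → h₀₁ ≡ o₀₁ ℚ.+ (a₁ ℚ.+ b₀₁) →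
        a₁₁ ≡ q * h₀₁ ℚ.+ T₁ * a₁ →
        b₁₁ ≡ (T₁ * o₁₀ ℚ.+ ((q ℚ.+ 1ℚ) * a₁₀ ℚ.+ T₁ * b₁)) ℚ.+ q * b₁ →
        h₁₁ ≡ o₁₁ ℚ.+ (a₁₁ ℚ.+ b₁₁) →
        h₁₁ ≡ s * (h₀₁ ℚ.+ h₁₀) ℚ.+ (q * (q ℚ.+ 1ℚ) - s * s) * h
      combine o a b a₁ b₁ refl refl refl refl refl refl refl refl refl refl refl =
        H-rec-identity q t o a b a₁ b₁

    H-y : ∀ y ys → H [] (y ∷ ys) ≡ s * H [] ys
    H-y y ys = combine (O [] ys) (Hʸ [] ys)
      (H-split [] ys) (O-y [] y ys) (Hʸ-y [] y ys) (H-split [] (y ∷ ys))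
      where
      combine : ∀ o b {h o₁ b₁ h₁} → h ≡ o ℚ.+ (0ℚ ℚ.+ b) → o₁ ≡ q * o →
        b₁ ≡ (T₁ * o ℚ.+ ((q ℚ.+ 1ℚ) * 0ℚ ℚ.+ T₁ * b)) ℚ.+ q * b → h₁ ≡ o₁ ℚ.+ (0ℚ ℚ.+ b₁) → h₁ ≡ s * h
      combine o b refl refl refl refl = solve 4 (λ q T o b →
          q :* o :+ (con 0ℚ :+ (T :* o :+ ((q :+ con 1ℚ) :* con 0ℚ :+ T :* b) :+ q :* b))
          := (q :+ T) :* (o :+ (con 0ℚ :+ b))) refl q T₁ o b

    H-x : ∀ x xs → H (x ∷ xs) [] ≡ s * H xs []
    H-x x xs = combine (O xs []) (Hˣ xs [])
      (H-split xs []) (O-x x xs []) (Hˣ-x x xs []) (H-split (x ∷ xs) [])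
      where
      combine : ∀ o a {h o₁ a₁ h₁} → h ≡ o ℚ.+ (a ℚ.+ 0ℚ) → o₁ ≡ T₁ * o →
        a₁ ≡ q * h ℚ.+ T₁ * a → h₁ ≡ o₁ ℚ.+ (a₁ ℚ.+ 0ℚ) → h₁ ≡ s * h
      combine o a refl refl refl refl = solve 4 (λ q T o a →
          T :* o :+ ((q :* (o :+ (a :+ con 0ℚ)) :+ T :* a) :+ con 0ℚ)
          := (q :+ T) :* (o :+ (a :+ con 0ℚ))) refl q T₁ o a

    H≡G : ∀ xs ys → H xs ys ≡ G (length xs) (length ys)
    H≡G []       []       = refl
    H≡G []       (y ∷ ys) = ≡-trans (H-y y ys) (cong (s *_) (H≡G [] ys))
    H≡G (x ∷ xs) []       = ≡-trans (H-x x xs) (cong (s *_) (≡-trans (H≡G xs []) (G-zeroʳ (length xs))))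
    H≡G (x ∷ xs) (y ∷ ys) = ≡-trans (H-rec x xs y ys)
      (cong₂ (λ a b → s * a ℚ.+ (q * (q ℚ.+ 1ℚ) - s * s) * b)
        (cong₂ ℚ._+_ (H≡G xs (y ∷ ys)) (H≡G (x ∷ xs) ys)) (H≡G xs ys))

*-÷-cancel : ∀ p r (r≢0 : r ≢ 0ℚ) → r * (_÷_ p r {{≢-nonZero r≢0}}) ≡ p
*-÷-cancel p r r≢0 = ≡-trans (solve 3 (λ r p i → r :* (p :* i) := p :* (r :* i)) refl r p _)
  (≡-trans (cong (p *_) (ℚₚ.*-inverseʳ r {{≢-nonZero r≢0}})) (ℚₚ.*-identityʳ p))
  where open +-*-Solver

module _ (q t : ℚ) {Q U : ℚ} (qQ : q * Q ≡ q ℚ.+ 1ℚ) (qU : (q ℚ.+ 1ℚ) * U ≡ t ℚ.+ 1ℚ) where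

  open Triangles q t

  monomial : ∀ a e d c f → pow q ((a + e) + ((d + c) + f)) * (pow Q (e + d + c) * pow U (e + d)) ≡
    pow q a * pow T₁ e * (pow q f * pow T₁ d * pow (q ℚ.+ 1ℚ) c)
  monomial a e d c f = combine
    (pow q a) (pow q e) (pow q d) (pow q c) (pow q f) (pow Q e) (pow Q d) (pow Q c) (pow U e) (pow U d)
    (≡-trans (pow-+ q (a + e) _) (cong₂ _*_ (pow-+ q a e) (≡-trans (pow-+ q (d + c) f) (cong (_* pow q f) (pow-+ q d c)))))
    (≡-trans (pow-+ Q (e + d) c) (cong (_* pow Q c) (pow-+ Q e d))) (pow-+ U e d)
    (pow-T e) (pow-T d) (≡-trans (cong (λ z → pow z c) (sym qQ)) (pow-* q Q c))
    where
    pow-T : ∀ k → pow T₁ k ≡ pow q k * pow Q k * pow U k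
    pow-T k = ≡-trans (cong (λ z → pow z k) (sym (≡-trans (cong (_* U) qQ) qU)))
      (≡-trans (pow-* (q * Q) U k) (cong (_* pow U k) (pow-* q Q k)))
    combine : ∀ qa qe qd qc qf Qe Qd Qc Ue Ud {x y z Te Td S} →
      x ≡ qa * qe * (qd * qc * qf) → y ≡ Qe * Qd * Qc → z ≡ Ue * Ud →
      Te ≡ qe * Qe * Ue → Td ≡ qd * Qd * Ud → S ≡ qc * Qc →
      x * (y * z) ≡ qa * Te * (qf * Td * S)
    combine qa qe qd qc qf Qe Qd Qc Ue Ud refl refl refl refl refl refl = solve 10
      (λ qa qe qd qc qf Qe Qd Qc Ue Ud →
        qa :* qe :* (qd :* qc :* qf) :* (Qe :* Qd :* Qc :* (Ue :* Ud)) :=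
        qa :* (qe :* Qe :* Ue) :* (qf :* (qd :* Qd :* Ud) :* (qc :* Qc)))
      refl qa qe qd qc qf Qe Qd Qc Ue Ud
      where open +-*-Solver

  module _ (m n : ℕ) (inC inI : Word m n → ℕ)
    (hC : ∀ u → T (isShuf u) → HasCount (CoveredBy u) (inC u))
    (hI : ∀ u → T (isShuf u) → HasCount (IndelCoveredBy u) (inI u)) where

    term : ∀ w → Sorted w → #y w ℕ.≤ n →
      pow q (m + n) * (pow Q (inC w) * pow U (inI w)) ≡ weight m n w
    term w s #y≤n = ≡-trans (cong₂ (λ k l → pow q k * l) size
        (cong₂ (λ k l → pow Q k * pow U l)
          (≡-trans (HasCount-unique (hC w (Sorted⇒isShuf s)) (covers-count s)) (length-covers w))
          (≡-trans (HasCount-unique (hI w (Sorted⇒isShuf s)) (indelCovers-count s)) (length-indelCovers w))))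
      (≡-trans (monomial (#x w) e d c f)
        (cong (λ k → pow q (#x w) * pow T₁ k * (pow q f * pow T₁ d * pow (q ℚ.+ 1ℚ) c)) e≡))
      where
      e = length (absentX w)
      d = length (dels w)
      c = length (swaps w)
      f = n ℕ.∸ #y w
      x+e : #x w + e ≡ m
      x+e = present+absent (Sorted⇒Unique s)
      size : m + n ≡ (#x w + e) + ((d + c) + f)
      size = sym (cong₂ _+_ x+e (≡-trans (cong (_+ f) (dels+swaps w)) (ℕₚ.m+[n∸m]≡n #y≤n)))
      e≡ : e ≡ m ℕ.∸ #x w
      e≡ = ≡-trans (sym (ℕₚ.m+n∸m≡n (#x w) e)) (cong (ℕ._∸ #x w) x+e)

    Htri≡G : pow q (m + n) * Htri m n inC inI Q U ≡ G m n
    Htri≡G = ≡-trans (sym (∑-*ˡ (pow q (m + n)) (Shuf m n) _))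
      (≡-trans (∑-↭ summand (Shuf↭shuffles m n))
      (≡-trans (∑-cong-∈ (shuffles xs ys) {summand} {weight m n} λ {w} w∈ →
          term w (proj₁ (shuffles⁻ xs ys (allFin-sorted m) (allFin-sorted n) w∈))
            (subst (#y w ℕ.≤_) (length-allFin n) (#y≤ xs ys w∈)))
      (≡-trans (∑-cong (shuffles xs ys) λ w →
          cong₂ (λ a b → weight a b w) (sym (length-allFin m)) (sym (length-allFin n)))
      (≡-trans (H≡G xs ys) (cong₂ G (length-allFin m) (length-allFin n))))))
      where
      xs = allFin m
      ys = allFin n
      summand : Word m n → ℚ
      summand u = pow q (m + n) * (pow Q (inC u) * pow U (inI u))

-- The F-triangle

∑-filterᵇ : ∀ (p : A → Bool) xs f → ∑ (filterᵇ p xs) f ≡ ∑ xs (λ x → if p x then f x else 0ℚ)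
∑-filterᵇ p []       f = refl
∑-filterᵇ p (x ∷ xs) f with p x
... | true  = cong (f x ℚ.+_) (∑-filterᵇ p xs f)
... | false = ≡-trans (∑-filterᵇ p xs f) (sym (ℚₚ.+-identityˡ _))

∑-sublists-∷ : ∀ (x : A) xs f → ∑ (sublists (x ∷ xs)) f ≡ ∑ (sublists xs) (f ∘ (x ∷_)) ℚ.+ ∑ (sublists xs) f
∑-sublists-∷ x xs f = ≡-trans (∑-++ (map (x ∷_) (sublists xs)) f) (cong (ℚ._+ _) (∑-map (x ∷_) (sublists xs)))

∑-sublists-++ : ∀ (xs ys : List A) f →
  ∑ (sublists (xs ++ ys)) f ≡ ∑ (sublists xs) (λ α → ∑ (sublists ys) (λ β → f (α ++ β)))
∑-sublists-++ []       ys f = sym (ℚₚ.+-identityʳ _)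
∑-sublists-++ (x ∷ xs) ys f = ≡-trans (∑-sublists-∷ x (xs ++ ys) f)
  (≡-trans (cong₂ ℚ._+_ (∑-sublists-++ xs ys (f ∘ (x ∷_))) (∑-sublists-++ xs ys f))
    (sym (∑-sublists-∷ x xs _)))

∑-sublists-map : ∀ (g : A → B) xs f → ∑ (sublists (map g xs)) f ≡ ∑ (sublists xs) (f ∘ map g)
∑-sublists-map g []       f = refl
∑-sublists-map g (x ∷ xs) f = ≡-trans (∑-sublists-∷ (g x) (map g xs) f)
  (≡-trans (cong₂ ℚ._+_ (∑-sublists-map g xs (f ∘ (g x ∷_))) (∑-sublists-map g xs f))
    (sym (∑-sublists-∷ x xs (f ∘ map g))))

∈-sublists⇒⊆ : ∀ (xs : List A) {ys} → ys ∈ sublists xs → ∀ {y} → y ∈ ys → y ∈ xs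
∈-sublists⇒⊆ []       (here refl) ()
∈-sublists⇒⊆ (x ∷ xs) h y∈ with ∈-++⁻ (map (x ∷_) (sublists xs)) h
... | inj₂ p = there (∈-sublists⇒⊆ xs p y∈)
... | inj₁ p with ∈-map⁻ (x ∷_) p
∈-sublists⇒⊆ (x ∷ xs) h (here refl) | inj₁ p | _ , q , refl = here refl
∈-sublists⇒⊆ (x ∷ xs) h (there y∈)  | inj₁ p | _ , q , refl = there (∈-sublists⇒⊆ xs q y∈)

sublists-AllPairs : ∀ {R : A → A → Set} {xs ys} → AllPairs R xs → ys ∈ sublists xs → AllPairs R ys
sublists-AllPairs []                  (here refl) = []
sublists-AllPairs {xs = x ∷ xs} (x≺ ∷ s) h with ∈-++⁻ (map (x ∷_) (sublists xs)) h
... | inj₂ p = sublists-AllPairs s p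
... | inj₁ p with ∈-map⁻ (x ∷_) p
... | _ , q , refl = All.tabulate (All.lookup x≺ ∘ ∈-sublists⇒⊆ xs q) ∷ sublists-AllPairs s q

all-cong : ∀ {f g : A → Bool} xs → (∀ x → f x ≡ g x) → all f xs ≡ all g xs
all-cong []       h = refl
all-cong (x ∷ xs) h = cong₂ _∧_ (h x) (all-cong xs h)

all-++ : ∀ (f : A → Bool) xs {ys} → all f (xs ++ ys) ≡ all f xs ∧ all f ys
all-++ f []       = refl
all-++ f (x ∷ xs) = ≡-trans (cong (f x ∧_) (all-++ f xs)) (sym (Boolₚ.∧-assoc (f x) _ _))

any-++ : ∀ (f : A → Bool) xs {ys} → any f (xs ++ ys) ≡ any f xs ∨ any f ys
any-++ f []       = refl
any-++ f (x ∷ xs) = ≡-trans (cong (f x ∨_) (any-++ f xs)) (sym (Boolₚ.∨-assoc (f x) _ _))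

all-map : ∀ (f : B → Bool) (g : A → B) xs → all f (map g xs) ≡ all (f ∘ g) xs
all-map f g []       = refl
all-map f g (x ∷ xs) = cong (f (g x) ∧_) (all-map f g xs)

all-map-true : ∀ (f : B → Bool) (g : A → B) xs → (∀ x → f (g x) ≡ true) → all f (map g xs) ≡ true
all-map-true f g []       h = refl
all-map-true f g (x ∷ xs) h rewrite h x = all-map-true f g xs h

any-map-false : ∀ (f : B → Bool) (g : A → B) xs → (∀ x → f (g x) ≡ false) → any f (map g xs) ≡ false
any-map-false f g []       h = refl
any-map-false f g (x ∷ xs) h rewrite h x = any-map-false f g xs h

any-map : ∀ (f : B → Bool) (g : A → B) xs → any f (map g xs) ≡ any (f ∘ g) xs
any-map f g []       = refl
any-map f g (x ∷ xs) = cong (f (g x) ∨_) (any-map f g xs)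

T-ext : ∀ {b c} → (T b → T c) → (T c → T b) → b ≡ c
T-ext {false} {false} f g = refl
T-ext {false} {true}  f g = ⊥-elim (g tt)
T-ext {true}  {false} f g = ⊥-elim (f tt)
T-ext {true}  {true}  f g = refl

all⁺ : ∀ (f : A → Bool) {xs} → All (T ∘ f) xs → T (all f xs)
all⁺ f []       = tt
all⁺ f (p ∷ ps) = Equivalence.from T-∧ (p , all⁺ f ps)

all⁻ : ∀ (f : A → Bool) xs → T (all f xs) → All (T ∘ f) xs
all⁻ f []       h = []
all⁻ f (x ∷ xs) h = let p , ps = Equivalence.to (T-∧ {f x}) h in p ∷ all⁻ f xs ps

Pair : ℕ → ℕ → Set
Pair m n = Fin (suc m) × Fin (suc n)

edge′ : Pair m n → Vertex m n
edge′ = uncurry edge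

row : Fin (suc m) → List (Fin (suc n)) → List (Pair m n)
row a = map (a ,_)

rows : List (Fin (suc m)) → List (Pair m n)
rows = concatMap (λ a → row a (allFin _))

cells : (m n : ℕ) → List (Pair m n)
cells m n = row Fin.zero (tabulate Fin.suc) ++ rows (tabulate Fin.suc)

edge-rows : ∀ (as : List (Fin (suc m))) →
  map edge′ (rows {m} {n} as) ≡ concatMap (λ a → map (edge a) (allFin (suc n))) as
edge-rows as = ≡-trans (Listₚ.map-concatMap edge′ (λ a → row a (allFin _)) as)
  (Listₚ.concatMap-cong (λ a → sym (Listₚ.map-∘ (allFin _))) as)

vertices≡ : ∀ m n → vertices m n ≡ map loopX (allFin m) ++ map loopY (allFin n) ++ map edge′ (cells m n)
vertices≡ m n = cong (λ es → map loopX (allFin m) ++ map loopY (allFin n) ++ es)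
  (edges _ (λ _ → refl) (λ _ _ → refl))
  where
  edges : ∀ (p : Vertex m n → Bool) →
    (∀ j → p (edge Fin.zero (Fin.suc j)) ≡ true) → (∀ i b → p (edge (Fin.suc i) b) ≡ true) →
    filterᵇ p (map (edge Fin.zero) (tabulate Fin.suc) ++
      concatMap (λ a → map (edge a) (allFin (suc n))) (tabulate Fin.suc)) ≡ map edge′ (cells m n)
  edges p h₁ h₂ = ≡-trans
    (Listₚ.filter-all (T? ∘ p) (Allₚ.++⁺ (Allₚ.map⁺ (Allₚ.tabulate⁺ λ j → subst T (sym (h₁ j)) tt))
      (Allₚ.concat⁺ (Allₚ.map⁺ (Allₚ.tabulate⁺ λ i → Allₚ.map⁺ (Allₚ.tabulate⁺ λ b → subst T (sym (h₂ i b)) tt))))))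
    (sym (≡-trans (Listₚ.map-++ edge′ (row Fin.zero (tabulate Fin.suc)) (rows (tabulate Fin.suc)))
      (cong₂ _++_ (sym (Listₚ.map-∘ (tabulate Fin.suc))) (edge-rows (tabulate Fin.suc)))))

-- Index zero stands for x_0 (or y_0), which carries no loop.
free : ∀ {k} → List (Fin k) → Fin (suc k) → Bool
free L Fin.zero    = true
free L (Fin.suc i) = not (any (eqF i) L)

compat : Pair m n → Pair m n → Bool
compat (s₁ , t₁) (s₂ , t₂) = not (toℕ s₁ ℕ.<ᵇ toℕ s₂) ∨ not (toℕ t₂ ℕ.<ᵇ toℕ t₁)

Lex : Pair m n → Pair m n → Set
Lex (a , b) (c , d) = a Fin.< c ⊎ (a ≡ c × b Fin.< d)

compat⇒≤ : ∀ (e f : Pair m n) → Lex e f → T (compat e f) → toℕ (proj₂ e) ℕ.≤ toℕ (proj₂ f)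
compat⇒≤ (a , b) (c , d) (inj₂ (_ , b<d)) _ = ℕₚ.<⇒≤ b<d
compat⇒≤ (a , b) (c , d) (inj₁ a<c) h with toℕ a ℕ.<ᵇ toℕ c in eq₁ | toℕ d ℕ.<ᵇ toℕ b in eq₂
... | false | _     = ⊥-elim (subst T eq₁ (ℕₚ.<⇒<ᵇ a<c))
... | true  | false = ℕₚ.≮⇒≥ λ d<b → subst T eq₂ (ℕₚ.<⇒<ᵇ d<b)

≤⇒compat : ∀ (e f : Pair m n) → toℕ (proj₂ e) ℕ.≤ toℕ (proj₂ f) → T (compat e f)
≤⇒compat (a , b) (c , d) b≤d with toℕ a ℕ.<ᵇ toℕ c | toℕ d ℕ.<ᵇ toℕ b in eq
... | false | _     = tt
... | true  | false = tt
... | true  | true  = ℕₚ.<⇒≱ (ℕₚ.<ᵇ⇒< (toℕ d) (toℕ b) (subst T (sym eq) tt)) b≤d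

Lex⇒compat : ∀ (e f : Pair m n) → Lex e f → T (compat f e)
Lex⇒compat (a , b) (c , d) l with toℕ c ℕ.<ᵇ toℕ a in eq | l
... | false | _               = tt
... | true  | inj₁ a<c        = ⊥-elim (ℕₚ.<-asym a<c (ℕₚ.<ᵇ⇒< _ _ (subst T (sym eq) tt)))
... | true  | inj₂ (refl , _) = ⊥-elim (ℕₚ.<-irrefl refl (ℕₚ.<ᵇ⇒< _ (toℕ a) (subst T (sym eq) tt)))

compat-self : ∀ (e : Pair m n) → T (compat e e)
compat-self e = ≤⇒compat e e ℕₚ.≤-refl

noncrossing⁻ : ∀ {E : List (Pair m n)} → AllPairs Lex E → All (λ e → All (T ∘ compat e) E) E →
  AllPairs (λ e f → toℕ (proj₂ e) ℕ.≤ toℕ (proj₂ f)) E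
noncrossing⁻ []       _                = []
noncrossing⁻ {E = e ∷ E} (l ∷ ls) ((_ ∷ h) ∷ hs) =
  All.zipWith (λ {f} (lex , c) → compat⇒≤ e f lex c) (l , h) ∷ noncrossing⁻ ls (All.map All.tail hs)

noncrossing⁺ : ∀ {E : List (Pair m n)} → AllPairs Lex E → AllPairs (λ e f → toℕ (proj₂ e) ℕ.≤ toℕ (proj₂ f)) E →
  All (λ e → All (T ∘ compat e) E) E
noncrossing⁺ []       []       = []
noncrossing⁺ {E = e ∷ E} (l ∷ ls) (p ∷ ps) =
  (compat-self e ∷ All.map (λ {f} → ≤⇒compat e f) p) ∷
  All.zipWith (λ {f} (lex , h) → Lex⇒compat e f lex ∷ h) (l , noncrossing⁺ ls ps)

module _ (fx : Fin (suc m) → Bool) (fy : Fin (suc n) → Bool) where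

  usable : Pair m n → Bool
  usable (a , b) = fx a ∧ fy b

  chainᵇ : ℕ → List (Pair m n) → Bool
  chainᵇ k []            = true
  chainᵇ k ((a , b) ∷ E) = usable (a , b) ∧ (k ℕ.≤ᵇ toℕ b) ∧ chainᵇ (toℕ b) E

  chainᵇ⁻ : ∀ k E → T (chainᵇ k E) → All (T ∘ usable) E × All (λ e → k ℕ.≤ toℕ (proj₂ e)) E ×
    AllPairs (λ e f → toℕ (proj₂ e) ℕ.≤ toℕ (proj₂ f)) E
  chainᵇ⁻ k []            _ = [] , [] , []
  chainᵇ⁻ k ((a , b) ∷ E) h =
    let u , h′    = Equivalence.to (T-∧ {usable (a , b)}) h
        k≤b , h″  = Equivalence.to (T-∧ {k ℕ.≤ᵇ toℕ b}) h′
        us , ls , ps = chainᵇ⁻ (toℕ b) E h″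
        k≤b′ = ℕₚ.≤ᵇ⇒≤ k (toℕ b) k≤b
    in u ∷ us , k≤b′ ∷ All.map (ℕₚ.≤-trans k≤b′) ls , ls ∷ ps

  chainᵇ⁺ : ∀ k E → All (T ∘ usable) E → All (λ e → k ℕ.≤ toℕ (proj₂ e)) E →
    AllPairs (λ e f → toℕ (proj₂ e) ℕ.≤ toℕ (proj₂ f)) E → T (chainᵇ k E)
  chainᵇ⁺ k []      _        _          _        = tt
  chainᵇ⁺ k (e ∷ E) (u ∷ us) (k≤b ∷ ls) (p ∷ ps) =
    Equivalence.from T-∧ (u , Equivalence.from T-∧ (ℕₚ.≤⇒≤ᵇ k≤b , chainᵇ⁺ _ E us p ps))

  chain≡ : ∀ {E} → AllPairs Lex E → all usable E ∧ all (λ e → all (compat e) E) E ≡ chainᵇ 0 E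
  chain≡ {E} ls = T-ext
    (λ h → let u , c = Equivalence.to (T-∧ {all usable E}) h in
      chainᵇ⁺ 0 E (all⁻ usable E u) (All.universal (λ _ → ℕ.z≤n) E)
        (noncrossing⁻ ls (All.map (λ {e} → all⁻ (compat e) E) (all⁻ (λ e → all (compat e) E) E c))))
    (λ h → let us , _ , ps = chainᵇ⁻ 0 E h in
      Equivalence.from T-∧ (all⁺ usable us ,
        all⁺ (λ e → all (compat e) E) (All.map (λ {e} → all⁺ (compat e)) (noncrossing⁺ ls ps))))

countᵇ-++ : ∀ (p : A → Bool) xs {ys} → countᵇ p (xs ++ ys) ≡ countᵇ p xs + countᵇ p ys
countᵇ-++ p xs {ys} = ≡-trans (cong length (Listₚ.filter-++ (T? ∘ p) xs ys)) (Listₚ.length-++ (filterᵇ p xs))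

countᵇ-all : ∀ (p : B → Bool) (g : A → B) xs → (∀ x → p (g x) ≡ true) →
  countᵇ p (map g xs) ≡ length xs
countᵇ-all p g []       h = refl
countᵇ-all p g (x ∷ xs) h rewrite h x = cong suc (countᵇ-all p g xs h)

countᵇ-none : ∀ (p : B → Bool) (g : A → B) xs → (∀ x → p (g x) ≡ false) →
  countᵇ p (map g xs) ≡ 0
countᵇ-none p g []       h = refl
countᵇ-none p g (x ∷ xs) h rewrite h x = countᵇ-none p g xs h

module _ {m n : ℕ} (A : List (Fin m)) (B : List (Fin n)) (E : List (Pair m n)) where

  private
    σ : List (Vertex m n)
    σ = map loopX A ++ map loopY B ++ map edge′ E

    all-σ : ∀ f → (∀ i → f (loopX i) ≡ true) → (∀ j → f (loopY j) ≡ true) → all f σ ≡ all (f ∘ edge′) E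
    all-σ f hx hy = ≡-trans (all-++ f (map loopX A)) (≡-trans (cong₂ _∧_ (all-map-true f loopX A hx)
      (≡-trans (all-++ f (map loopY B)) (cong₂ _∧_ (all-map-true f loopY B hy) refl))) (all-map f edge′ E))

    mem-X : ∀ i → memᵇ (loopX i) σ ≡ any (eqF i) A
    mem-X i = ≡-trans (any-++ (eqV (loopX i)) (map loopX A)) (≡-trans (cong₂ _∨_ (any-map (eqV (loopX i)) loopX A)
      (≡-trans (any-++ (eqV (loopX i)) (map loopY B)) (cong₂ _∨_ (any-map-false (eqV (loopX i)) loopY B λ _ → refl)
        (any-map-false (eqV (loopX i)) edge′ E λ _ → refl)))) (Boolₚ.∨-identityʳ _))

    mem-Y : ∀ j → memᵇ (loopY j) σ ≡ any (eqF j) B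
    mem-Y j = ≡-trans (any-++ (eqV (loopY j)) (map loopX A)) (≡-trans (cong₂ _∨_ (any-map-false (eqV (loopY j)) loopX A λ _ → refl)
      (≡-trans (any-++ (eqV (loopY j)) (map loopY B)) (cong₂ _∨_ (any-map (eqV (loopY j)) loopY B)
        (any-map-false (eqV (loopY j)) edge′ E λ _ → refl)))) (Boolₚ.∨-identityʳ _))

  condI≡ : condI σ ≡ all (usable (free A) (free B)) E
  condI≡ = ≡-trans (all-σ _ (λ _ → refl) (λ _ → refl)) (all-cong E λ where
    (Fin.zero  , Fin.zero)  → refl
    (Fin.zero  , Fin.suc j) → cong not (mem-Y j)
    (Fin.suc i , Fin.zero)  → cong (λ b → not b ∧ true) (mem-X i)
    (Fin.suc i , Fin.suc j) → cong₂ (λ a b → not a ∧ not b) (mem-X i) (mem-Y j))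

  condII≡ : condII σ ≡ all (λ e → all (compat e) E) E
  condII≡ = ≡-trans
    (all-σ _ (λ i → all-true σ (λ _ → refl)) (λ i → all-true σ (λ _ → refl)))
    (all-cong E λ e → ≡-trans (all-σ _ (λ _ → refl) (λ _ → refl)) (all-cong E λ f → refl))
    where
    all-true : ∀ {f : Vertex m n → Bool} xs → (∀ x → f x ≡ true) → all f xs ≡ true
    all-true []       h = refl
    all-true (x ∷ xs) h = ≡-trans (cong₂ _∧_ (h x) refl) (all-true xs h)

  isFace≡ : AllPairs Lex E → isFace σ ≡ chainᵇ (free A) (free B) 0 E
  isFace≡ ls = ≡-trans (cong₂ _∧_ condI≡ condII≡) (chain≡ (free A) (free B) ls)

  count-edges : countᵇ isEdge σ ≡ length E
  count-edges = ≡-trans (countᵇ-++ isEdge (map loopX A)) (cong₂ _+_ (countᵇ-none isEdge loopX A λ _ → refl)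
    (≡-trans (countᵇ-++ isEdge (map loopY B)) (cong₂ _+_ (countᵇ-none isEdge loopY B λ _ → refl)
      (countᵇ-all isEdge edge′ E λ _ → refl))))

  count-loops : countᵇ isLoop σ ≡ length A + length B
  count-loops = ≡-trans (countᵇ-++ isLoop (map loopX A)) (cong₂ _+_ (countᵇ-all isLoop loopX A λ _ → refl)
    (≡-trans (countᵇ-++ isLoop (map loopY B)) (≡-trans (cong₂ _+_ (countᵇ-all isLoop loopY B λ _ → refl)
      (countᵇ-none isLoop edge′ E λ _ → refl)) (ℕₚ.+-identityʳ _))))

All-after : ∀ {R : A → A → Set} {b bs} xs → AllPairs R (xs ++ b ∷ bs) → All (R b) bs
All-after []       (p ∷ _) = p
All-after (x ∷ xs) (_ ∷ s) = All-after xs s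

All-before : ∀ {R : A → A → Set} {b bs} xs → AllPairs R (xs ++ b ∷ bs) → All (λ x → R x b) xs
All-before []       _       = []
All-before (x ∷ xs) (p ∷ s) = All.lookup p (∈-++⁺ʳ xs (here refl)) ∷ All-before xs s

module Chains (q t : ℚ) where

  open Triangles q t
  open +-*-Solver

  Z : Bool → (List Bool → ℚ) → List Bool → ℚ
  Z r f []      = 0ℚ
  Z r f (c ∷ γ) = (if r ∧ c then q * (f (c ∷ γ) ℚ.+ Z r f γ) else 0ℚ) ℚ.+ Z r f γ

  L : List Bool → List Bool → ℚ
  L []      γ = 1ℚ
  L (r ∷ ρ) γ = L ρ γ ℚ.+ Z r (L ρ) γ

  D : List Bool → List Bool → ℚ
  D ρ γ = L ρ (true ∷ γ) ℚ.+ Z true (L ρ) γ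

  Z-cong : ∀ r {f g} → (∀ γ → f γ ≡ g γ) → ∀ γ → Z r f γ ≡ Z r g γ
  Z-cong r h []      = refl
  Z-cong r h (c ∷ γ) = cong₂ (λ a b → (if r ∧ c then q * (a ℚ.+ b) else 0ℚ) ℚ.+ b) (h (c ∷ γ)) (Z-cong r h γ)

  Z-false : ∀ f γ → Z false f γ ≡ 0ℚ
  Z-false f []      = refl
  Z-false f (c ∷ γ) = ≡-trans (ℚₚ.+-identityˡ _) (Z-false f γ)

  Z-skip : ∀ r f γ → Z r f (false ∷ γ) ≡ Z r f γ
  Z-skip true  f γ = ℚₚ.+-identityˡ _
  Z-skip false f γ = ℚₚ.+-identityˡ _

  L-falseˡ : ∀ ρ γ → L (false ∷ ρ) γ ≡ L ρ γ
  L-falseˡ ρ γ = ≡-trans (cong (L ρ γ ℚ.+_) (Z-false (L ρ) γ)) (ℚₚ.+-identityʳ _)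

  L-true-false : ∀ ρ γ → L ρ (true ∷ false ∷ γ) ≡ L ρ (true ∷ γ)
  L-true-false []      γ = refl
  L-true-false (r ∷ ρ) γ = cong₂ (λ a z → a ℚ.+ ((if r ∧ true then q * (a ℚ.+ z) else 0ℚ) ℚ.+ z))
    (L-true-false ρ γ) (Z-skip r (L ρ) γ)

  L-true-true : ∀ ρ γ → L (true ∷ ρ) (true ∷ γ) ≡ (1ℚ ℚ.+ q) * D ρ γ
  L-true-true ρ γ = solve 3 (λ q l z → l :+ (q :* (l :+ z) :+ z) := (con 1ℚ :+ q) :* (l :+ z)) refl
    q (L ρ (true ∷ γ)) (Z true (L ρ) γ)

  D-falseˡ : ∀ ρ γ → D (false ∷ ρ) γ ≡ D ρ γ
  D-falseˡ ρ γ = cong₂ ℚ._+_ (L-falseˡ ρ (true ∷ γ)) (Z-cong true (L-falseˡ ρ) γ)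

  D-falseʳ : ∀ ρ γ → D ρ (false ∷ γ) ≡ D ρ γ
  D-falseʳ ρ γ = cong₂ ℚ._+_ (L-true-false ρ γ) (Z-skip true (L ρ) γ)

  -- Inclusion–exclusion: a chain avoiding the corner avoids the
  -- whole first row or the whole first column.
  D-true-true : ∀ ρ γ → D (true ∷ ρ) (true ∷ γ) ≡ (1ℚ ℚ.+ q) * (D ρ (true ∷ γ) ℚ.+ D (true ∷ ρ) γ - D ρ γ)
  D-true-true ρ γ = combine (Z true (L (true ∷ ρ)) (true ∷ γ))
    (L-true-true ρ (true ∷ γ)) (L-true-true ρ γ) (L-true-true (true ∷ ρ) γ)
    where
    combine : ∀ z {l₁ l₂ d₀₁ d₁₀ d} → l₁ ≡ (1ℚ ℚ.+ q) * d₀₁ → l₂ ≡ (1ℚ ℚ.+ q) * d →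
      l₂ ℚ.+ z ≡ (1ℚ ℚ.+ q) * d₁₀ → l₁ ℚ.+ z ≡ (1ℚ ℚ.+ q) * (d₀₁ ℚ.+ d₁₀ - d)
    combine z {d₀₁ = d₀₁} {d₁₀} {d} refl refl e = ≡-trans
      (solve 4 (λ q d₀₁ d z → (con 1ℚ :+ q) :* d₀₁ :+ z :=
        (con 1ℚ :+ q) :* (d₀₁ :- d) :+ ((con 1ℚ :+ q) :* d :+ z)) refl q d₀₁ d z)
      (≡-trans (cong ((1ℚ ℚ.+ q) * (d₀₁ - d) ℚ.+_) e)
        (solve 4 (λ q d₀₁ d₁₀ d → (con 1ℚ :+ q) :* (d₀₁ :- d) :+ (con 1ℚ :+ q) :* d₁₀ :=
          (con 1ℚ :+ q) :* (d₀₁ :+ d₁₀ :- d)) refl q d₀₁ d₁₀ d))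

  D-[]-true : ∀ γ → D [] (true ∷ γ) ≡ (1ℚ ℚ.+ q) * D [] γ
  D-[]-true γ = L-true-true [] γ

  D-true-[] : ∀ ρ → D (true ∷ ρ) [] ≡ (1ℚ ℚ.+ q) * D ρ []
  D-true-[] ρ = ≡-trans (ℚₚ.+-identityʳ _) (L-true-true ρ [])

  S : ℕ → (List Bool → ℚ) → ℚ
  S zero    g = g []
  S (suc k) g = S k (g ∘ (true ∷_)) ℚ.+ t * S k (g ∘ (false ∷_))

  S-cong : ∀ k {f g} → (∀ γ → f γ ≡ g γ) → S k f ≡ S k g
  S-cong zero    h = h []
  S-cong (suc k) h = cong₂ (λ a b → a ℚ.+ t * b) (S-cong k (h ∘ (true ∷_))) (S-cong k (h ∘ (false ∷_)))

  S-+* : ∀ k c f g → S k (λ γ → f γ ℚ.+ c * g γ) ≡ S k f ℚ.+ c * S k g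
  S-+* zero    c f g = refl
  S-+* (suc k) c f g = ≡-trans (cong₂ (λ a b → a ℚ.+ t * b) (S-+* k c _ _) (S-+* k c _ _))
    (solve 6 (λ t c a b d e → a :+ c :* b :+ t :* (d :+ c :* e) := a :+ t :* d :+ c :* (b :+ t :* e)) refl t c
      (S k (f ∘ (true ∷_))) (S k (g ∘ (true ∷_))) (S k (f ∘ (false ∷_))) (S k (g ∘ (false ∷_))))

  S-* : ∀ k c g → S k (λ γ → c * g γ) ≡ c * S k g
  S-* zero    c g = refl
  S-* (suc k) c g = ≡-trans (cong₂ (λ a b → a ℚ.+ t * b) (S-* k c _) (S-* k c _))
    (solve 4 (λ t c b e → c :* b :+ t :* (c :* e) := c :* (b :+ t :* e)) refl t c
      (S k (g ∘ (true ∷_))) (S k (g ∘ (false ∷_))))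

  S-ie : ∀ k c f g h → S k (λ γ → c * (f γ ℚ.+ g γ - h γ)) ≡ c * (S k f ℚ.+ S k g - S k h)
  S-ie zero    c f g h = refl
  S-ie (suc k) c f g h = ≡-trans (cong₂ (λ a b → a ℚ.+ t * b) (S-ie k c _ _ _) (S-ie k c _ _ _))
    (solve 8 (λ t c a a′ b b′ d d′ → c :* (a :+ b :- d) :+ t :* (c :* (a′ :+ b′ :- d′)) :=
      c :* (a :+ t :* a′ :+ (b :+ t :* b′) :- (d :+ t :* d′))) refl t c
      (S k (f ∘ (true ∷_))) (S k (f ∘ (false ∷_))) (S k (g ∘ (true ∷_))) (S k (g ∘ (false ∷_)))
      (S k (h ∘ (true ∷_))) (S k (h ∘ (false ∷_))))

  S² : ℕ → ℕ → (List Bool → List Bool → ℚ) → ℚ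
  S² m n f = S m (λ ρ → S n (f ρ))

  F : ℕ → ℕ → ℚ
  F m n = S² m n D

  F-x : ∀ m n → F (suc m) n ≡ S² m n (D ∘ (true ∷_)) ℚ.+ t * F m n
  F-x m n = cong (λ a → S² m n (D ∘ (true ∷_)) ℚ.+ t * a) (S-cong m λ ρ → S-cong n (D-falseˡ ρ))

  S-y : ∀ n ρ → S (suc n) (D ρ) ≡ S n (D ρ ∘ (true ∷_)) ℚ.+ t * S n (D ρ)
  S-y n ρ = cong (λ a → S n (D ρ ∘ (true ∷_)) ℚ.+ t * a) (S-cong n (D-falseʳ ρ))

  F-y : ∀ m n → F m (suc n) ≡ S² m n (λ ρ → D ρ ∘ (true ∷_)) ℚ.+ t * F m n
  F-y m n = ≡-trans (S-cong m (S-y n)) (S-+* m t _ _)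

  F-rec : ∀ m n → F (suc m) (suc n) ≡
    s * (F m (suc n) ℚ.+ F (suc m) n) ℚ.+ (q * (q ℚ.+ 1ℚ) - s * s) * F m n
  F-rec m n = combine (S² m n (D ∘ (true ∷_))) (S² m n (λ ρ → D ρ ∘ (true ∷_))) (F m n)
    (F-x m n) (F-y m n) corner
    (≡-trans (S-cong m (λ ρ → S-y n (true ∷ ρ))) (S-+* m t _ _))
    (F-x m (suc n))
    where
    corner : S² m n (λ ρ γ → D (true ∷ ρ) (true ∷ γ)) ≡
      (1ℚ ℚ.+ q) * (S² m n (λ ρ → D ρ ∘ (true ∷_)) ℚ.+ S² m n (D ∘ (true ∷_)) - F m n)
    corner = ≡-trans
      (S-cong m λ ρ → ≡-trans (S-cong n (D-true-true ρ)) (S-ie n (1ℚ ℚ.+ q) (D ρ ∘ (true ∷_)) (D (true ∷ ρ)) (D ρ)))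
      (S-ie m (1ℚ ℚ.+ q) (λ ρ → S n (D ρ ∘ (true ∷_))) (λ ρ → S n (D (true ∷ ρ))) (λ ρ → S n (D ρ)))
    combine : ∀ p r f {f₁₀ f₀₁ x y f₁₁} → f₁₀ ≡ p ℚ.+ t * f → f₀₁ ≡ r ℚ.+ t * f →
      x ≡ (1ℚ ℚ.+ q) * (r ℚ.+ p - f) → y ≡ x ℚ.+ t * p → f₁₁ ≡ y ℚ.+ t * f₀₁ →
      f₁₁ ≡ s * (f₀₁ ℚ.+ f₁₀) ℚ.+ (q * (q ℚ.+ 1ℚ) - s * s) * f
    combine p r f refl refl refl refl refl = solve 5 (λ q t p r f →
      let s = q :+ (t :+ con 1ℚ) in
      (con 1ℚ :+ q) :* (r :+ p :- f) :+ t :* p :+ t :* (r :+ t :* f) :=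
      s :* (r :+ t :* f :+ (p :+ t :* f)) :+ (q :* (q :+ con 1ℚ) :- s :* s) :* f) refl q t p r f

  linear : ∀ a → (1ℚ ℚ.+ q) * a ℚ.+ t * a ≡ s * a
  linear a = solve 3 (λ q t a → (con 1ℚ :+ q) :* a :+ t :* a := (q :+ (t :+ con 1ℚ)) :* a) refl q t a

  F≡G : ∀ m n → F m n ≡ G m n
  F≡G zero zero = refl
  F≡G zero (suc n) = ≡-trans (F-y zero n)
    (≡-trans (cong (ℚ._+ t * F zero n) (≡-trans (S-cong n D-[]-true) (S-* n (1ℚ ℚ.+ q) (D []))))
      (≡-trans (linear (F zero n)) (cong (s *_) (F≡G zero n))))
  F≡G (suc m) zero = ≡-trans (F-x m zero)
    (≡-trans (cong (ℚ._+ t * F m zero) (≡-trans (S-cong m D-true-[]) (S-* m (1ℚ ℚ.+ q) (λ ρ → D ρ []))))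
      (≡-trans (linear (F m zero)) (cong (s *_) (≡-trans (F≡G m zero) (G-zeroʳ m)))))
  F≡G (suc m) (suc n) = ≡-trans (F-rec m n)
    (cong₂ (λ a b → s * a ℚ.+ (q * (q ℚ.+ 1ℚ) - s * s) * b)
      (cong₂ ℚ._+_ (F≡G m (suc n)) (F≡G (suc m) n)) (F≡G m n))

  sum-subsets : ∀ {k} (xs : List (Fin k)) → Unique xs → ∀ g →
    ∑ (sublists xs) (λ A → pow t (length A) * g (map (λ i → not (any (eqF i) A)) xs)) ≡ S (length xs) g
  sum-subsets []       _          g = ≡-trans (ℚₚ.+-identityʳ _) (ℚₚ.*-identityˡ _)
  sum-subsets {k} (x ∷ xs) u@(_ ∷ us) g = ≡-trans (∑-sublists-∷ x xs _) (≡-trans (cong₂ ℚ._+_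
      (≡-trans (∑-cong-∈ (sublists xs) λ {A} A∈ →
          ≡-trans (cong (λ ρ → t * pow t (length A) * g ρ) (used A)) (ℚₚ.*-assoc t _ _))
        (≡-trans (∑-*ˡ t (sublists xs) _) (cong (t *_) (sum-subsets xs us (g ∘ (false ∷_))))))
      (≡-trans (∑-cong-∈ (sublists xs) λ {A} A∈ →
          cong (λ b → pow t (length A) * g (not b ∷ map (λ i → not (any (eqF i) A)) xs)) (unused A A∈))
        (sum-subsets xs us (g ∘ (true ∷_)))))
      (ℚₚ.+-comm (t * S (length xs) (g ∘ (false ∷_))) _))
    where
    x∉xs : x ∉ xs
    x∉xs = Uniqueₚ.Unique[x∷xs]⇒x∉xs u
    eqF-refl : ∀ (i : Fin k) → eqF i i ≡ true
    eqF-refl i with i Fin.≟ i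
    ... | yes _  = refl
    ... | no i≢i = ⊥-elim (i≢i refl)
    eqF-≢ : ∀ {i j : Fin k} → i ≢ j → eqF i j ≡ false
    eqF-≢ {i} {j} i≢j with i Fin.≟ j
    ... | yes e = ⊥-elim (i≢j e)
    ... | no _  = refl
    used : ∀ A → map (λ i → not (any (eqF i) (x ∷ A))) (x ∷ xs) ≡ false ∷ map (λ i → not (any (eqF i) A)) xs
    used A = cong₂ _∷_ (cong (λ b → not (b ∨ any (eqF x) A)) (eqF-refl x))
      (Listₚ.map-cong-local (All.tabulate λ {y} y∈ →
        cong (λ b → not (b ∨ any (eqF y) A)) (eqF-≢ {y} {x} λ { refl → x∉xs y∈ })))
    unused : ∀ A → A ∈ sublists xs → any (eqF x) A ≡ false
    unused A A∈ = go A (∈-sublists⇒⊆ xs A∈)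
      where
      go : ∀ B → (∀ {y} → y ∈ B → y ∈ xs) → any (eqF x) B ≡ false
      go []      h = refl
      go (y ∷ B) h = cong₂ _∨_ (eqF-≢ {x} {y} λ { refl → x∉xs (h (here refl)) }) (go B (h ∘ there))

  module _ {m n : ℕ} (fx : Fin (suc m) → Bool) (fy : Fin (suc n) → Bool) where

    chainSum : ℕ → List (Pair m n) → ℚ
    chainSum k cs = ∑ (sublists cs) (λ E → if chainᵇ fx fy k E then pow q (length E) else 0ℚ)

    ∑-if : ∀ {A : Set} b (p : A → Bool) xs (f : A → ℚ) →
      ∑ xs (λ x → if b ∧ p x then q * f x else 0ℚ) ≡ (if b then q * ∑ xs (λ x → if p x then f x else 0ℚ) else 0ℚ)
    ∑-if false p []       f = refl
    ∑-if false p (x ∷ xs) f = ≡-trans (ℚₚ.+-identityˡ _) (∑-if false p xs f)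
    ∑-if true  p xs       f = ≡-trans (∑-cong xs pull) (∑-*ˡ q xs _)
      where
      pull : ∀ x → (if p x then q * f x else 0ℚ) ≡ q * (if p x then f x else 0ℚ)
      pull x with p x
      ... | true  = refl
      ... | false = sym (ℚₚ.*-zeroʳ q)

    chainSum-∷ : ∀ k a b cs → chainSum k ((a , b) ∷ cs) ≡
      (if usable fx fy (a , b) ∧ (k ℕ.≤ᵇ toℕ b) then q * chainSum (toℕ b) cs else 0ℚ) ℚ.+ chainSum k cs
    chainSum-∷ k a b cs = ≡-trans (∑-sublists-∷ (a , b) cs _) (cong (ℚ._+ chainSum k cs)
      (≡-trans (∑-cong (sublists cs) λ E → cong (λ c → if c then q * pow q (length E) else 0ℚ)
          (sym (Boolₚ.∧-assoc (usable fx fy (a , b)) (k ℕ.≤ᵇ toℕ b) _)))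
        (∑-if _ (chainᵇ fx fy (toℕ b)) (sublists cs) (pow q ∘ length))))

    chainSum-below : ∀ k a bs cs → All (λ b → toℕ b ℕ.< k) bs → chainSum k (row a bs ++ cs) ≡ chainSum k cs
    chainSum-below k a []       cs _        = refl
    chainSum-below k a (b ∷ bs) cs (p ∷ ps) = ≡-trans (chainSum-∷ k a b (row a bs ++ cs))
      (≡-trans (cong (λ c → (if usable fx fy (a , b) ∧ c then q * chainSum (toℕ b) (row a bs ++ cs) else 0ℚ)
          ℚ.+ chainSum k (row a bs ++ cs)) k≰b)
        (≡-trans (cong (λ c → (if c then q * chainSum (toℕ b) (row a bs ++ cs) else 0ℚ)
            ℚ.+ chainSum k (row a bs ++ cs)) (Boolₚ.∧-zeroʳ (usable fx fy (a , b))))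
          (≡-trans (ℚₚ.+-identityˡ _) (chainSum-below k a bs cs ps))))
      where
      k≰b : (k ℕ.≤ᵇ toℕ b) ≡ false
      k≰b = T-ext (λ h → ℕₚ.<⇒≱ p (ℕₚ.≤ᵇ⇒≤ k (toℕ b) h)) ⊥-elim

    columns : List (Fin (suc n))
    columns = allFin (suc n)

    Computes : List (Pair m n) → (List Bool → ℚ) → Set
    Computes cs f = ∀ pre b bs → columns ≡ pre ++ b ∷ bs → chainSum (toℕ b) cs ≡ f (map fy (b ∷ bs))

    chainSum-row : ∀ {cs f} a → Computes cs f → ∀ k v → chainSum k cs ≡ v →
      ∀ pre bs → columns ≡ pre ++ bs → All (λ b → k ℕ.≤ toℕ b) bs →
      chainSum k (row a bs ++ cs) ≡ v ℚ.+ Z (fx a) f (map fy bs)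
    chainSum-row a comp k v e pre [] _ _ = ≡-trans e (sym (ℚₚ.+-identityʳ v))
    chainSum-row {cs} {f} a comp k v e pre (b ∷ bs) eq (k≤b ∷ k≤) =
      ≡-trans (chainSum-∷ k a b (row a bs ++ cs)) (≡-trans (cong₂ ℚ._+_
        (cong₂ (λ c z → if c then q * z else 0ℚ) available
          (chainSum-row {cs} {f} a comp (toℕ b) _ (comp pre b bs eq) (pre ++ b ∷ []) bs eq′ b≤))
        (chainSum-row {cs} {f} a comp k v e (pre ++ b ∷ []) bs eq′ k≤))
        (solve 3 (λ x v z → x :+ (v :+ z) := v :+ (x :+ z)) refl
          (if fx a ∧ fy b then q * (f (map fy (b ∷ bs)) ℚ.+ Z (fx a) f (map fy bs)) else 0ℚ) v (Z (fx a) f (map fy bs))))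
      where
      eq′ : columns ≡ (pre ++ b ∷ []) ++ bs
      eq′ = ≡-trans eq (sym (Listₚ.++-assoc pre (b ∷ []) bs))
      available : (fx a ∧ fy b) ∧ (k ℕ.≤ᵇ toℕ b) ≡ fx a ∧ fy b
      available = ≡-trans (cong ((fx a ∧ fy b) ∧_) (T-ext {c = true} (λ _ → tt) (λ _ → ℕₚ.≤⇒≤ᵇ k≤b)))
        (Boolₚ.∧-identityʳ _)
      b≤ : All (λ c → toℕ b ℕ.≤ toℕ c) bs
      b≤ = All.map ℕₚ.<⇒≤ (All-after pre (subst (AllPairs Fin._<_) eq (allFin-sorted (suc n))))

    rows-compute : ∀ as → Computes (rows as) (L (map fx as))
    rows-compute []       pre b bs eq = ℚₚ.+-identityʳ _
    rows-compute (a ∷ as) pre b bs eq = ≡-trans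
      (cong (λ cs → chainSum (toℕ b) (cs ++ rows as)) (≡-trans (cong (row a) eq) (Listₚ.map-++ (a ,_) pre (b ∷ bs))))
      (≡-trans (cong (chainSum (toℕ b)) (Listₚ.++-assoc (row a pre) (row a (b ∷ bs)) (rows as)))
      (≡-trans (chainSum-below (toℕ b) a pre (row a (b ∷ bs) ++ rows as) (All-before pre sorted))
        (chainSum-row a (rows-compute as) (toℕ b) _ (rows-compute as pre b bs eq) pre (b ∷ bs) eq
          (ℕₚ.≤-refl ∷ All.map ℕₚ.<⇒≤ (All-after pre sorted)))))
      where
      sorted : AllPairs Fin._<_ (pre ++ b ∷ bs)
      sorted = subst (AllPairs Fin._<_) eq (allFin-sorted (suc n))

    chainSum-cells : fx Fin.zero ≡ true → fy Fin.zero ≡ true →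
      chainSum 0 (cells m n) ≡ D (map fx (tabulate Fin.suc)) (map fy (tabulate Fin.suc))
    chainSum-cells hx hy = ≡-trans
      (chainSum-row Fin.zero (rows-compute (tabulate Fin.suc)) 0 _
        (rows-compute (tabulate Fin.suc) [] Fin.zero (tabulate Fin.suc) refl)
        (Fin.zero ∷ []) (tabulate Fin.suc) refl (All.universal (λ _ → ℕ.z≤n) _))
      (cong₂ (λ a b → L (map fx (tabulate Fin.suc)) (b ∷ map fy (tabulate Fin.suc))
        ℚ.+ Z a (L (map fx (tabulate Fin.suc))) (map fy (tabulate Fin.suc))) hx hy)

  cells-Lex : ∀ m n → AllPairs Lex (cells m n)
  cells-Lex m n = AllPairsₚ.++⁺ (row-Lex Fin.zero (AllPairs.tail (allFin-sorted (suc n))))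
    (rows-Lex (AllPairs.tail (allFin-sorted (suc m))))
    (Allₚ.map⁺ (All.universal (λ b → rows-above (AllPairs.head (allFin-sorted (suc m)))) _))
    where
    row-Lex : ∀ a {bs : List (Fin (suc n))} → AllPairs Fin._<_ bs → AllPairs Lex (row {m} a bs)
    row-Lex a s = AllPairsₚ.map⁺ (AllPairs.map (λ b<c → inj₂ (refl , b<c)) s)
    rows-above : ∀ {a b as} → All (a Fin.<_) as → All (Lex (a , b)) (rows {m} {n} as)
    rows-above ps = Allₚ.concat⁺ (Allₚ.map⁺ (All.map (λ a<c → Allₚ.map⁺ (All.universal (λ _ → inj₁ a<c) _)) ps))
    rows-Lex : ∀ {as} → AllPairs Fin._<_ as → AllPairs Lex (rows {m} {n} as)
    rows-Lex []      = []
    rows-Lex (p ∷ s) = AllPairsₚ.++⁺ (row-Lex _ (allFin-sorted (suc n))) (rows-Lex s)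
      (Allₚ.map⁺ (All.universal (λ _ → rows-above p) _))

  flags : ∀ {k} → List (Fin k) → List Bool
  flags A = map (λ i → not (any (eqF i) A)) (allFin _)

  free-flags : ∀ {k} (A : List (Fin k)) → map (free A) (tabulate Fin.suc) ≡ flags A
  free-flags A = ≡-trans (cong (map (free A)) (sym (Listₚ.map-tabulate (λ i → i) Fin.suc)))
    (sym (Listₚ.map-∘ (allFin _)))

  face-sum : ∀ (A : List (Fin m)) (B : List (Fin n)) →
    ∑ (sublists (cells m n)) (λ E → let σ = map loopX A ++ map loopY B ++ map edge′ E in
      if isFace σ then pow q (countᵇ isEdge σ) * pow t (countᵇ isLoop σ) else 0ℚ)
    ≡ pow t (length A) * (pow t (length B) * D (flags A) (flags B))
  face-sum {m} {n} A B = ≡-trans (∑-cong-∈ (sublists (cells m n)) simplify)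
    (≡-trans (∑-*ˡ (pow t (length A + length B)) (sublists (cells m n)) _)
    (≡-trans (cong₂ _*_ (pow-+ t (length A) (length B))
        (≡-trans (chainSum-cells (free A) (free B) refl refl) (cong₂ D (free-flags A) (free-flags B))))
      (ℚₚ.*-assoc (pow t (length A)) _ _)))
    where
    simplify : ∀ {E} → E ∈ sublists (cells m n) → let σ = map loopX A ++ map loopY B ++ map edge′ E in
      (if isFace σ then pow q (countᵇ isEdge σ) * pow t (countᵇ isLoop σ) else 0ℚ)
      ≡ pow t (length A + length B) * (if chainᵇ (free A) (free B) 0 E then pow q (length E) else 0ℚ)
    simplify {E} E∈ = ≡-trans
      (cong₂ (λ b v → if b then v else 0ℚ) (isFace≡ A B E (sublists-AllPairs (cells-Lex m n) E∈))
        (cong₂ (λ k l → pow q k * pow t l) (count-edges A B E) (count-loops A B E)))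
      (pull (chainᵇ (free A) (free B) 0 E))
      where
      pull : ∀ b → (if b then pow q (length E) * pow t (length A + length B) else 0ℚ) ≡
        pow t (length A + length B) * (if b then pow q (length E) else 0ℚ)
      pull true  = ℚₚ.*-comm (pow q (length E)) _
      pull false = sym (ℚₚ.*-zeroʳ (pow t (length A + length B)))

  Ftri≡G : ∀ m n → Ftri m n q t ≡ G m n
  Ftri≡G m n = ≡-trans (∑-filterᵇ isFace (sublists (vertices m n)) _)
    (≡-trans (cong (λ V → ∑ (sublists V) φ) (vertices≡ m n))
    (≡-trans (∑-sublists-++ (map loopX (allFin m)) _ φ)
    (≡-trans (∑-sublists-map loopX (allFin m) _)
    (≡-trans (∑-cong (sublists (allFin m)) inner)
    (≡-trans (sum-subsets (allFin m) (Uniqueₚ.allFin⁺ m) (λ ρ → S (length (allFin n)) (D ρ)))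
    (≡-trans (cong₂ (λ k l → S² k l D) (length-allFin m) (length-allFin n)) (F≡G m n)))))))
    where
    φ : List (Vertex m n) → ℚ
    φ σ = if isFace σ then pow q (countᵇ isEdge σ) * pow t (countᵇ isLoop σ) else 0ℚ
    inner : ∀ A → ∑ (sublists (map loopY (allFin n) ++ map edge′ (cells m n))) (λ β → φ (map loopX A ++ β)) ≡
      pow t (length A) * S (length (allFin n)) (D (flags A))
    inner A = ≡-trans (∑-sublists-++ (map loopY (allFin n)) _ _)
      (≡-trans (∑-sublists-map loopY (allFin n) _)
      (≡-trans (∑-cong (sublists (allFin n)) λ B →
          ≡-trans (∑-sublists-map edge′ (cells m n) _) (face-sum A B))
      (≡-trans (∑-*ˡ (pow t (length A)) (sublists (allFin n)) _)
        (cong (pow t (length A) *_) (sum-subsets (allFin n) (Uniqueₚ.allFin⁺ n) (D (flags A)))))))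

theorem1p1 : (m n : ℕ) (inC inI : Word m n → ℕ) →
    (∀ u → T (isShuf u) → HasCount (CoveredBy u) (inC u)) →
    (∀ u → T (isShuf u) → HasCount (IndelCoveredBy u) (inI u)) →
    (q t : ℚ) (hq : q ≢ 0ℚ) (hq1 : q Data.Rational.+ 1ℚ ≢ 0ℚ) →
    Ftri m n q t ≡
    pow q (m + n) * Htri m n inC inI
    (_÷_ (q Data.Rational.+ 1ℚ) q {{≢-nonZero hq}})
    (_÷_ (t Data.Rational.+ 1ℚ) (q Data.Rational.+ 1ℚ) {{≢-nonZero hq1}})
theorem1p1 m n inC inI hC hI q t hq hq1 = ≡-trans (Chains.Ftri≡G q t m n) (sym
  (Htri≡G q t (*-÷-cancel (q ℚ.+ 1ℚ) q hq) (*-÷-cancel (t ℚ.+ 1ℚ) (q ℚ.+ 1ℚ) hq1) m n inC inI hC hI))
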